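{- If $G$ is a $\{P_5,\overline{P_5},\text{bull}\}$-free graph, then at least one of the following holds: $|V(G)|\le 2$; $G$ is isomorphic to $C_5$; $G$ has a homogeneous set; $G$ or $\overline{G}$ is a half graph.
   Context: All graphs are finite and simple. $P_n$ is the path on $n$ vertices, $C_n$ the cycle of length $n$, $\overline{G}$ the complement. $G$ is $\mathcal F$-free if it has no induced subgraph isomorphic to a member of $\mathcal F$. The bull is the graph with vertex set $\{x_1,x_2,x_3,y,z\}$ and edge set $\{x_1x_2,x_2x_3,x_1x_3,x_1y,x_2z\}$. A vertex $b\notin X$ is mixed on $X$ if it has both a neighbor and a non-neighbor in $X$. A homogeneous set is a set $X\subseteq V(G)$ with $1<|X|<|V(G)|$ such that no vertex outside $X$ is mixed on $X$. For $k\ge1$, $O_k$ is the bipartite graph with vertex set $\{a_1,\dots,a_k,b_1,\dots,b_k\}$ in which the only edges are $a_ib_j$ for $i+j\ge k+1$; a half graph is a graph isomorphic to $O_k$ for some $k$. -}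

module Defs where

open import Data.Empty using (⊥)
open import Data.Fin.Base using (Fin; toℕ)
open import Data.Fin.Properties using () renaming (_≟_ to _≟ᶠ_)
open import Data.Fin.Subset using (Subset; _∈_; _∉_; ∣_∣)
open import Data.List.Base using (List)
open import Data.List.Relation.Unary.All using (All)
open import Data.Nat.Base using (ℕ; suc; _+_; _≤_; _<_; _≥_; s≤s)
open import Data.Nat.Properties using (_≟_; _≤?_; 1+n≢n)
open import Data.Product.Base using (∃; _×_; _,_; proj₁; proj₂)
open import Data.Sum.Base using (_⊎_; inj₁; inj₂; [_,_]; swap)
open import Function.Bundles using (_↔_; _⇔_; Inverse)
open import Level using (0ℓ) renaming (suc to lsuc)
open import Relation.Binary.Core using (Rel)
open import Relation.Binary.Definitions using (Decidable; Irreflexive; Symmetric)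
open import Relation.Binary.PropositionalEquality.Core using (_≡_; _≢_; refl; sym; ≢-sym)
open import Relation.Nullary.Decidable using (yes; no; True; toWitness; ¬?; _×-dec_; _⊎-dec_)
open import Relation.Nullary.Negation using (¬_)

-- Finiteness is not a field: a finite simple graph is a Graph (Fin n).
-- Adjacency is decidable, so that "neighbour or non-neighbour" holds
-- constructively.
record Graph (V : Set) : Set (lsuc 0ℓ) where
  infix 4 _~_ _~?_
  field
    _~_      : Rel V 0ℓ
    ~-sym    : Symmetric _~_
    ~-irrefl : Irreflexive _≡_ _~_
    _~?_     : Decidable _~_

open Graph using () renaming (_~_ to Adj) public

infix 4 _≅_

record _≅_ {V W : Set} (G : Graph V) (H : Graph W) : Set where
  field
    bijection : V ↔ W
    adjacency : ∀ u v → Adj G u v ⇔ Adj H (Inverse.to bijection u) (Inverse.to bijection v)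

complement : ∀ {n} → Graph (Fin n) → Graph (Fin n)
complement G = record
  { _~_      = λ u v → u ≢ v × ¬ Adj G u v
  ; ~-sym    = λ (u≢v , u≁v) → ≢-sym u≢v , λ v~u → u≁v (Graph.~-sym G v~u)
  ; ~-irrefl = λ u≡v (u≢v , _) → u≢v u≡v
  ; _~?_     = λ u v → ¬? (u ≟ᶠ v) ×-dec ¬? (Graph._~?_ G u v)
  }

induced : ∀ {n} → Graph (Fin n) → (X : Subset n) → Graph (∃ λ v → v ∈ X)
induced G X = record
  { _~_      = λ u v → Adj G (proj₁ u) (proj₁ v)
  ; ~-sym    = Graph.~-sym G
  ; ~-irrefl = λ { refl → Graph.~-irrefl G refl }
  ; _~?_     = λ u v → Graph._~?_ G (proj₁ u) (proj₁ v)
  }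

Free : ∀ {n} → List (∃ Graph) → Graph (Fin n) → Set₁
Free 𝓕 G = All (λ H → ¬ (∃ λ X → induced G X ≅ proj₂ H)) 𝓕

Mixed : ∀ {n} → Graph (Fin n) → Fin n → Subset n → Set
Mixed G b X = b ∉ X × (∃ λ x → x ∈ X × Adj G b x) × (∃ λ x → x ∈ X × ¬ Adj G b x)

Homogeneous : ∀ {n} → Graph (Fin n) → Subset n → Set
Homogeneous {n} G X = 1 < ∣ X ∣ × ∣ X ∣ < n × (∀ b → b ∉ X → ¬ Mixed G b X)

-- The graph whose edges are the pairs uv with E u v or E v u.
fromArcs : ∀ {V} (E : Rel V 0ℓ) → Irreflexive _≡_ E → Decidable E → Graph V
fromArcs E irr E? = record
  { _~_      = λ u v → E u v ⊎ E v u
  ; ~-sym    = swap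
  ; ~-irrefl = λ u≡v → [ irr u≡v , irr (sym u≡v) ]
  ; _~?_     = λ u v → E? u v ⊎-dec E? v u
  }

P : (n : ℕ) → Graph (Fin n)
P n = fromArcs
  (λ i j → toℕ j ≡ suc (toℕ i))
  (λ { refl eq → 1+n≢n (sym eq) })
  (λ i j → toℕ j ≟ suc (toℕ i))

C : (n : ℕ) {n≥3 : True (3 ≤? n)} → Graph (Fin n)
C n {n≥3} = fromArcs
  (λ i j → toℕ j ≡ suc (toℕ i) ⊎ (suc (toℕ i) ≡ n × toℕ j ≡ 0))
  (λ { refl (inj₁ eq)       → 1+n≢n (sym eq)
     ; refl (inj₂ (eq , z)) → n≢1 (toWitness n≥3) eq z })
  (λ i j → (toℕ j ≟ suc (toℕ i)) ⊎-dec ((suc (toℕ i) ≟ n) ×-dec (toℕ j ≟ 0)))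
  where
  n≢1 : ∀ {m k} → 3 ≤ m → suc k ≡ m → k ≢ 0
  n≢1 (s≤s ()) refl refl

data BullVertex : Set where
  x₁ x₂ x₃ y z : BullVertex

data BullArc : Rel BullVertex 0ℓ where
  x₁x₂ : BullArc x₁ x₂
  x₂x₃ : BullArc x₂ x₃
  x₁x₃ : BullArc x₁ x₃
  x₁y  : BullArc x₁ y
  x₂z  : BullArc x₂ z

bull : Graph BullVertex
bull = fromArcs BullArc (λ { refl () }) arc?
  where
  arc? : Decidable BullArc
  arc? x₁ x₁ = no λ ()
  arc? x₁ x₂ = yes x₁x₂
  arc? x₁ x₃ = yes x₁x₃
  arc? x₁ y  = yes x₁y
  arc? x₁ z  = no λ ()
  arc? x₂ x₁ = no λ ()
  arc? x₂ x₂ = no λ ()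
  arc? x₂ x₃ = yes x₂x₃
  arc? x₂ y  = no λ ()
  arc? x₂ z  = yes x₂z
  arc? x₃ _  = no λ ()
  arc? y  _  = no λ ()
  arc? z  _  = no λ ()

-- inj₁ i is a with index toℕ i + 1, inj₂ j is b with index toℕ j + 1.
HalfArc : (k : ℕ) → Rel (Fin k ⊎ Fin k) 0ℓ
HalfArc k (inj₁ i) (inj₂ j) = suc (toℕ i) + suc (toℕ j) ≥ k + 1
HalfArc k _        _        = ⊥

O : (k : ℕ) → Graph (Fin k ⊎ Fin k)
O k = fromArcs (HalfArc k) irr arc?
  where
  irr : Irreflexive _≡_ (HalfArc k)
  irr {inj₁ _} refl ()
  irr {inj₂ _} refl ()

  arc? : Decidable (HalfArc k)
  arc? (inj₁ i) (inj₂ j) = (k + 1) ≤? (suc (toℕ i) + suc (toℕ j))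
  arc? (inj₁ _) (inj₁ _) = no λ ()
  arc? (inj₂ _) _        = no λ ()

HalfGraph : ∀ {V} → Graph V → Set
HalfGraph G = ∃ λ k → k ≥ 1 × G ≅ O k

{-# OPTIONS --safe #-}
-- Take a {P₅, co-P₅, bull}-free graph without homogeneous sets.  A vertex outside an induced C₅ is
-- complete to it, anticomplete to it or a twin of one of its vertices.  The class of twins of a vertex
-- of the C₅ has no mixed vertex, so it is trivial; then the C₅ itself has no mixed vertex and is all
-- of G.  In any case G contains an induced P₄, that is O₂: starting from two singletons, a pair of
-- disjoint sets A, B that are complete or anticomplete to each other can be enlarged as long as it
-- does not cover G, unless a P₄ shows up, and a covering pair yields a homogeneous set.
-- If G is C₅-free, then given an induced O_k with k ≥ 2, each outside vertex is again complete,
-- anticomplete or a twin of some h in O_k.  If O_k is not all of G, some h has a twin, and a vertex w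
-- outside the twin class of h distinguishes two members of that class.
-- The local structure of w then inserts a new pair into O_k, giving O_{k+1}; for k = 2 it may give
-- O₃ in the complement instead.
module Submission where

open import Defs
open import Data.Bool.Base using (Bool; true; false)
open import Data.Empty using (⊥; ⊥-elim)
open import Data.Fin.Base as Fin using (Fin; zero; suc; toℕ; opposite)
open import Data.Fin.Patterns using (0F; 1F; 2F; 3F; 4F)
import Data.Fin.Properties as Finₚ
open import Data.Fin.Subset using (Subset; ∣_∣; ⁅_⁆; _∪_)
  renaming (_∈_ to _∈ˢ_; _∉_ to _∉ˢ_; _⊂_ to _⊂ˢ_; _⊃_ to _⊃ˢ_)
open import Data.Fin.Subset.Induction using (Acc; acc; ⊃-wellFounded)
import Data.Fin.Subset.Properties as Subsetₚ
open import Data.List.Base using (List; []; _∷_; _++_; length; lookup)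
open import Data.List.Membership.Propositional using (_∈_; find; lose)
open import Data.List.Membership.Propositional.Properties using (∈-∃++; ∈-++⁺ʳ; ∈-lookup)
open import Data.List.Properties using (++-assoc; length-++)
open import Data.List.Relation.Binary.Sublist.Propositional
  using (_⊆_; []; _∷_; _∷ʳ_; minimum; ⊆-refl; from∈)
open import Data.List.Relation.Binary.Sublist.Propositional.Properties using (++⁺; All-resp-⊆)
open import Data.List.Relation.Unary.All as All using (All; []; _∷_)
import Data.List.Relation.Unary.All.Properties as Allₚ
open import Data.List.Relation.Unary.AllPairs as AllPairs using (AllPairs; []; _∷_)
import Data.List.Relation.Unary.AllPairs.Properties as AllPairsₚ
open import Data.List.Relation.Unary.Any as Any using (Any; here; there)
import Data.List.Relation.Unary.Any.Properties as Anyₚ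
open import Data.Nat.Base using (ℕ; zero; suc; _+_; _∸_; _≤_; _<_; z≤n; s≤s)
import Data.Nat.Properties as ℕₚ
open import Data.Product.Base using (∃; _×_; _,_; -,_; proj₁; proj₂; swap; map₂)
open import Data.Sum.Base as Sum using (_⊎_; inj₁; inj₂)
open import Data.Vec.Base as Vec using (Vec; []; _∷_)
import Data.Vec.Properties as Vecₚ
import Data.Vec.Properties.WithK as VecWithKₚ
open import Function.Base using (_∘_; id)
open import Function.Bundles using (_⇔_; _↔_; mk⇔; mk↔ₛ′; Inverse; Equivalence)
open import Function.Construct.Identity using (↔-id)
open import Function.Definitions using (Injective)
open import Level using (0ℓ)
open import Relation.Binary.Core using (Rel)
open import Relation.Binary.Definitions using (Decidable; Symmetric; tri<; tri≈; tri>)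
open import Relation.Binary.PropositionalEquality
  using (_≡_; _≢_; refl; sym; trans; cong; subst; subst₂; ≢-sym)
open import Relation.Nullary.Decidable
  using (Dec; yes; no; does; map′; ¬?; _×-dec_; _⊎-dec_; _→-dec_; dec-true; decidable-stable)
open import Relation.Nullary.Negation using (¬_; contradiction)
import Relation.Unary as Unary

-- Lists

AllPairs-resp-⊆ : ∀ {A : Set} {R : Rel A 0ℓ} {xs ys} → xs ⊆ ys → AllPairs R ys → AllPairs R xs
AllPairs-resp-⊆ []         rs       = rs
AllPairs-resp-⊆ (_ ∷ʳ τ)   (_ ∷ rs) = AllPairs-resp-⊆ τ rs
AllPairs-resp-⊆ (refl ∷ τ) (r ∷ rs) = All-resp-⊆ τ r ∷ AllPairs-resp-⊆ τ rs

AllPairs-lookup : ∀ {A : Set} {R : A → A → Set} {xs} → AllPairs R xs →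
                  ∀ {i j} → i Fin.< j → R (lookup xs i) (lookup xs j)
AllPairs-lookup (r ∷ _)  {zero}  {suc j} _         = All.lookup r (∈-lookup j)
AllPairs-lookup (_ ∷ rs) {suc i} {suc j} (s≤s i<j) = AllPairs-lookup rs i<j

All-or-∃ : ∀ {A : Set} {Q R : A → Set} {xs} → All (λ x → Q x ⊎ R x) xs → All Q xs ⊎ (∃ λ x → x ∈ xs × R x)
All-or-∃ []            = inj₁ []
All-or-∃ (inj₂ r ∷ _)  = inj₂ (_ , here refl , r)
All-or-∃ (inj₁ q ∷ qs) with All-or-∃ qs
... | inj₁ all            = inj₁ (q ∷ all)
... | inj₂ (x , x∈xs , r) = inj₂ (x , there x∈xs , r)

-- Adjacency (E) and nonadjacency of distinct vertices (N) enter symmetrically, so that complementation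
-- is the exchange of the two.
record Colouring (V : Set) : Set₁ where
  field
    E N      : Rel V 0ℓ
    E-sym    : Symmetric E
    N-sym    : Symmetric N
    E-irrefl : ∀ {u} → ¬ E u u
    N-irrefl : ∀ {u} → ¬ N u u
    E∩N      : ∀ {u v} → E u v → ¬ N u v
    E∪N      : ∀ {u v} → u ≢ v → E u v ⊎ N u v
    E?       : Decidable E
    N?       : Decidable N

dual : ∀ {V} → Colouring V → Colouring V
dual c = record
  { E = N ; N = E ; E-sym = N-sym ; N-sym = E-sym ; E-irrefl = N-irrefl ; N-irrefl = E-irrefl
  ; E∩N = λ n e → E∩N e n ; E∪N = Sum.swap ∘ E∪N ; E? = N? ; N? = E? }
  where open Colouring c

-- Induced paths, forbidden subgraphs and primality

record P4 {V} (c : Colouring V) (p q r s : V) : Set where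
  constructor p4
  open Colouring c
  field
    pq : E p q
    qr : E q r
    rs : E r s
    pr : N p r
    ps : N p s
    qs : N q s

P4? : ∀ {V} (c : Colouring V) p q r s → Dec (P4 c p q r s)
P4? c p q r s = map′
  (λ (pq , qr , rs , pr , ps , qs) → p4 pq qr rs pr ps qs)
  (λ (p4 pq qr rs pr ps qs) → pq , qr , rs , pr , ps , qs)
  (E? p q ×-dec E? q r ×-dec E? r s ×-dec N? p r ×-dec N? p s ×-dec N? q s)
  where open Colouring c

P4-reverse : ∀ {V} {c : Colouring V} {p q r s} → P4 c p q r s → P4 c s r q p
P4-reverse {c = c} (p4 pq qr rs pr ps qs) =
  p4 (E-sym rs) (E-sym qr) (E-sym pq) (N-sym qs) (N-sym ps) (N-sym pr)
  where open Colouring c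

-- P₄ is self-complementary: the nonedges of p - q - r - s form the path r - p - s - q.
P4-dual : ∀ {V} {c : Colouring V} {p q r s} → P4 (dual c) p q r s → P4 c r p s q
P4-dual {c = c} (p4 pq qr rs pr ps qs) = p4 (E-sym pr) ps (E-sym qs) rs (N-sym qr) pq
  where open Colouring c

-- Each forbidden graph is an induced P₄ plus one vertex x: attached to an end it gives P₅, to the
-- two middle vertices the bull, to all but one middle vertex the house, which is the complement of
-- P₅.
record Restricted {V} (c : Colouring V) : Set where
  open Colouring c
  field
    noP5    : ∀ {p q r s x} → P4 c p q r s → E x p → N x q → N x r → N x s → ⊥
    noBull  : ∀ {p q r s x} → P4 c p q r s → N x p → E x q → E x r → N x s → ⊥
    noHouse : ∀ {p q r s x} → P4 c p q r s → E x p → E x q → N x r → E x s → ⊥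

  noP5′ : ∀ {p q r s x} → P4 c p q r s → N x p → N x q → N x r → E x s → ⊥
  noP5′ path np nq nr es = noP5 (P4-reverse path) es nr nq np

  noHouse′ : ∀ {p q r s x} → P4 c p q r s → E x p → N x q → E x r → E x s → ⊥
  noHouse′ path ep nq er es = noHouse (P4-reverse path) es er nq ep

-- Complementation exchanges P₅ with the house and fixes the bull.
Restricted-dual : ∀ {V} {c : Colouring V} → Restricted c → Restricted (dual c)
Restricted-dual restricted = record
  { noP5    = λ path np eq er es → noHouse′ (P4-dual path) er np es eq
  ; noBull  = λ path ep nq nr es → noBull (P4-dual path) nr ep es nq
  ; noHouse = λ path np nq er ns → noP5 (P4-dual path) er np ns nq }
  where open Restricted restricted

C5Free : ∀ {V} → Colouring V → Set
C5Free c = ∀ {p q r s x} → P4 c p q r s → E x p → N x q → N x r → E x s → ⊥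
  where open Colouring c

C5Free-dual : ∀ {V} {c : Colouring V} → C5Free c → C5Free (dual c)
C5Free-dual noC5 path np eq er ns = noC5 (P4-dual path) er np ns eq

-- The absence of homogeneous sets in positive form: the mixed vertex is delivered with both
-- witnesses. Quantifying over decidable predicates makes it directly applicable to classes of
-- twins.
Prime : ∀ {V} → Colouring V → Set₁
Prime {V} c = ∀ {Q : V → Set} → Unary.Decidable Q → ∀ {u v t} → Q u → Q v → u ≢ v → ¬ Q t →
  ∃ λ w → ∃ λ a → ∃ λ b → ¬ Q w × Q a × Q b × E w a × N w b
  where open Colouring c

Prime-dual : ∀ {V} {c : Colouring V} → Prime c → Prime (dual c)
Prime-dual prime Q? qu qv u≢v ¬qt =
  let w , a , b , ¬qw , qa , qb , ea , nb = prime Q? qu qv u≢v ¬qt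
  in  w , b , a , ¬qw , qb , qa , nb , ea

-- Half graphs

-- The half graph O_k is stored as the list (a₁ , b₁) , … , (a_k , b_k), numbered so that aᵢ and bⱼ
-- are adjacent iff i ≤ j; this aᵢ is the vertex a_{k+1−i} of the usual numbering.
module _ {V : Set} (c : Colouring V) where
  open Colouring c

  Rung : V × V → Set
  Rung (a , b) = E a b

  record Before (p q : V × V) : Set where
    constructor before
    field
      ab : E (proj₁ p) (proj₂ q)
      aa : N (proj₁ p) (proj₁ q)
      bb : N (proj₂ p) (proj₂ q)
      ba : N (proj₂ p) (proj₁ q)

  Half : List (V × V) → Set
  Half hs = AllPairs Before hs × All Rung hs

  before? : Decidable Before
  before? (a , b) (a′ , b′) = map′
    (λ (ab , aa , bb , ba) → before ab aa bb ba)
    (λ (before ab aa bb ba) → ab , aa , bb , ba)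
    (E? a b′ ×-dec N? a a′ ×-dec N? b b′ ×-dec N? b a′)

  half? : Unary.Decidable Half
  half? hs = AllPairs.allPairs? before? hs ×-dec All.all? (λ (a , b) → E? a b) hs

module HalfGraphs {V : Set} (c : Colouring V) where
  open Colouring c

  half-⊆ : ∀ {gs hs} → gs ⊆ hs → Half c hs → Half c gs
  half-⊆ τ (bs , rs) = AllPairs-resp-⊆ τ bs , All-resp-⊆ τ rs

  half-insert : ∀ gs {p hs} → Half c (gs ++ hs) → Rung c p →
                All (λ q → Before c q p) gs → All (Before c p) hs → Half c (gs ++ p ∷ hs)
  half-insert []       (bs , rs)           r []       ps = ps ∷ bs , r ∷ rs
  half-insert (g ∷ gs) (b ∷ bs , r′ ∷ rs) r (q ∷ qs) ps
    with bs′ , rs′ ← half-insert gs (bs , rs) r qs ps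
       = Allₚ.++⁺ (Allₚ.++⁻ˡ gs b) (q ∷ Allₚ.++⁻ʳ gs b) ∷ bs′ , r′ ∷ rs′

  before-left : ∀ {gs p hs} → Half c (gs ++ p ∷ hs) → ∀ {q} → q ∈ gs → Half c (q ∷ p ∷ [])
  before-left half q∈gs = half-⊆ (++⁺ (from∈ q∈gs) (refl ∷ minimum _)) half

  before-right : ∀ gs {p hs} → Half c (gs ++ p ∷ hs) → ∀ {q} → q ∈ hs → Half c (p ∷ q ∷ [])
  before-right gs half q∈hs = half-⊆ (++⁺ (minimum gs) (refl ∷ from∈ q∈hs)) half

  -- Reversing the list exchanges the roles of the a's and the b's.
  rev : List (V × V) → List (V × V)
  rev []       = []
  rev (h ∷ hs) = rev hs ++ swap h ∷ []

  rev-++ : ∀ gs p hs → rev (gs ++ p ∷ hs) ≡ rev hs ++ swap p ∷ rev gs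
  rev-++ []       p hs = refl
  rev-++ (g ∷ gs) p hs rewrite rev-++ gs p hs = ++-assoc (rev hs) (swap p ∷ rev gs) (swap g ∷ [])

  length-rev : ∀ hs → length (rev hs) ≡ length hs
  length-rev []       = refl
  length-rev (h ∷ hs) rewrite length-++ (rev hs) {swap h ∷ []} | length-rev hs = ℕₚ.+-comm (length hs) 1

  All-rev : ∀ {Q : V × V → Set} {hs} → All (Q ∘ swap) hs → All Q (rev hs)
  All-rev []       = []
  All-rev (q ∷ qs) = Allₚ.++⁺ (All-rev qs) (q ∷ [])

  half-rev : ∀ {hs} → Half c hs → Half c (rev hs)
  half-rev {[]}     ([] , [])         = [] , []
  half-rev {h ∷ hs} (b ∷ bs , r ∷ rs) with bs′ , rs′ ← half-rev (bs , rs) =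
    AllPairsₚ.++⁺ bs′ ([] ∷ [])
      (All-rev (All.map (λ (before ab aa bb ba) →
        before (E-sym ab) (N-sym bb) (N-sym aa) (N-sym ba) ∷ []) b)) ,
    Allₚ.++⁺ rs′ (E-sym r ∷ [])

  None OnlyA OnlyB Both : V → V × V → Set
  None  x (a , b) = N x a × N x b
  OnlyA x (a , b) = E x a × N x b
  OnlyB x (a , b) = N x a × E x b
  Both  x (a , b) = E x a × E x b

  data Status (x : V) (p : V × V) : Set where
    none  : None  x p → Status x p
    onlyA : OnlyA x p → Status x p
    onlyB : OnlyB x p → Status x p
    both  : Both  x p → Status x p

  status : ∀ {x a b} → x ≢ a → x ≢ b → Status x (a , b)
  status x≢a x≢b with E∪N x≢a | E∪N x≢b
  ... | inj₂ na | inj₂ nb = none  (na , nb)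
  ... | inj₁ ea | inj₂ nb = onlyA (ea , nb)
  ... | inj₂ na | inj₁ eb = onlyB (na , eb)
  ... | inj₁ ea | inj₁ eb = both  (ea , eb)

  -- The attachment of the `a` of one pair: nothing before it, its own `b`, and every later `b`. The
  -- choice between `OnlyB` and `Both` leaves open whether x is adjacent to the vertex that it
  -- copies.
  data TwinA (x : V) : List (V × V) → Set where
    here  : ∀ {p hs} → OnlyB x p ⊎ Both x p → All (OnlyB x) hs → TwinA x (p ∷ hs)
    there : ∀ {p hs} → None x p → TwinA x hs → TwinA x (p ∷ hs)

  data TwinB (x : V) : List (V × V) → Set where
    here  : ∀ {p hs} → OnlyA x p ⊎ Both x p → All (None x) hs → TwinB x (p ∷ hs)
    there : ∀ {p hs} → OnlyA x p → TwinB x hs → TwinB x (p ∷ hs)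

  -- A vertex complete to a single pair counts as a twin, hence the two pairs in `full`.
  data Attachment (x : V) : List (V × V) → Set where
    anti  : ∀ {hs} → All (None x) hs → Attachment x hs
    full  : ∀ {p q hs} → All (Both x) (p ∷ q ∷ hs) → Attachment x (p ∷ q ∷ hs)
    twinA : ∀ {hs} → TwinA x hs → Attachment x hs
    twinB : ∀ {hs} → TwinB x hs → Attachment x hs

  half-replace : ∀ p gs {q q′ hs} → Half c (p ∷ gs ++ q ∷ hs) → Before c p q′ →
                 Half c (gs ++ q′ ∷ hs) → Half c (p ∷ gs ++ q′ ∷ hs)
  half-replace p gs (b ∷ _ , r ∷ _) pq′ (bs , rs) with bs₁ , _ ∷ bs₂ ← Allₚ.++⁻ gs b =
    Allₚ.++⁺ bs₁ (pq′ ∷ bs₂) ∷ bs , r ∷ rs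

  -- The one adjacency that `TwinA` leaves open is to the replaced vertex, so it disappears from the
  -- new list.
  replaceA : ∀ {x hs} → Half c hs → TwinA x hs →
             ∃ λ gs → ∃ λ a → ∃ λ b → ∃ λ ks → hs ≡ gs ++ (a , b) ∷ ks × Half c (gs ++ (x , b) ∷ ks)
  replaceA (b ∷ bs , r ∷ rs) (here eb obs) = [] , _ , _ , _ , refl ,
    All.zipWith (λ (before ab aa bb ba , na , eb) → before eb na bb ba) (b , obs) ∷ bs ,
    Sum.[ proj₂ , proj₂ ] eb ∷ rs
  replaceA {hs = p ∷ _} half@(b ∷ bs , r ∷ rs) (there (na , nb) t)
    with gs , a′ , b′ , ks , refl , half′ ← replaceA (bs , rs) t
    with before ab aa bb ba ∷ _ ← Allₚ.++⁻ʳ gs b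
       = p ∷ gs , a′ , b′ , ks , refl , half-replace p gs half (before ab (N-sym na) bb (N-sym nb)) half′

  replaceB : ∀ {x hs} → Half c hs → TwinB x hs →
             ∃ λ gs → ∃ λ a → ∃ λ b → ∃ λ ks → hs ≡ gs ++ (a , b) ∷ ks × Half c (gs ++ (a , x) ∷ ks)
  replaceB (b ∷ bs , r ∷ rs) (here ea nones) = [] , _ , _ , _ , refl ,
    All.zipWith (λ (before ab aa bb ba , na , nb) → before ab aa nb na) (b , nones) ∷ bs ,
    E-sym (Sum.[ proj₁ , proj₁ ] ea) ∷ rs
  replaceB {hs = p ∷ _} half@(b ∷ bs , r ∷ rs) (there (ea , nb) t)
    with gs , a′ , b′ , ks , refl , half′ ← replaceB (bs , rs) t
    with before ab aa bb ba ∷ _ ← Allₚ.++⁻ʳ gs b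
       = p ∷ gs , a′ , b′ , ks , refl , half-replace p gs half (before (E-sym ea) aa (N-sym nb) ba) half′

-- Attachment of an outside vertex and insertion of a new pair

module HalfGrowth {V : Set} (c : Colouring V) (restricted : Restricted c) (noC5 : C5Free c) where
  open Colouring c
  open Restricted restricted
  open HalfGraphs c public

  half-path : ∀ {p q} → Half c (p ∷ q ∷ []) → P4 c (proj₂ p) (proj₁ p) (proj₂ q) (proj₁ q)
  half-path ((before ab aa bb ba ∷ []) ∷ _ , rp ∷ rq ∷ []) = p4 (E-sym rp) ab (E-sym rq) bb ba aa

  module _ {p q : V × V} {x : V} (half : Half c (p ∷ q ∷ [])) where
    private
      path = half-path half

    -- In this and the next five lemmas, x is the fifth vertex of a P₅, bull, house or C₅ on the
    -- path b - a - b′ - a′ formed by the two pairs.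
    none-A : None x p → ¬ OnlyA x q
    none-A (na , nb) (ea′ , nb′) = noP5′ path nb na nb′ ea′

    A-B : OnlyA x p → ¬ OnlyB x q
    A-B (ea , nb) (na′ , eb′) = noBull path nb ea eb′ na′

    B-none : OnlyB x p → ¬ None x q
    B-none (na , eb) (na′ , nb′) = noP5 path eb na nb′ na′

    B-A : OnlyB x p → ¬ OnlyA x q
    B-A (na , eb) (ea′ , nb′) = noC5 path eb na nb′ ea′

    B-both : OnlyB x p → ¬ Both x q
    B-both (na , eb) (ea′ , eb′) = noHouse′ path eb na eb′ ea′

    both-A : Both x p → ¬ OnlyA x q
    both-A (ea , eb) (ea′ , nb′) = noHouse path eb ea nb′ ea′

  module _ {p q r : V × V} {x : V} where
    private
      -- A third pair gives further induced paths: b₂ - a₁ - b₃ - a₃ here, and b₁ - a₁ - b₃ - a₂ for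
      -- `path₂`.
      path₁ : Half c (p ∷ q ∷ r ∷ []) → P4 c (proj₂ q) (proj₁ p) (proj₂ r) (proj₁ r)
      path₁ ((pq ∷ pr ∷ []) ∷ (qr ∷ []) ∷ _ , rp ∷ rq ∷ rr ∷ []) =
        p4 (E-sym (Before.ab pq)) (Before.ab pr) (E-sym rr) (Before.bb qr) (Before.ba qr) (Before.aa pr)

      path₂ : Half c (p ∷ q ∷ r ∷ []) → P4 c (proj₂ p) (proj₁ p) (proj₂ r) (proj₁ q)
      path₂ ((pq ∷ pr ∷ []) ∷ (qr ∷ []) ∷ _ , rp ∷ rq ∷ rr ∷ []) =
        p4 (E-sym rp) (Before.ab pr) (E-sym (Before.ab qr)) (Before.bb pr) (Before.ba pq) (Before.aa pq)

    none-both-both : Half c (p ∷ q ∷ r ∷ []) → None x p → Both x q → ¬ Both x r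
    none-both-both half (na , nb) (ea′ , eb′) (ea″ , eb″) = noHouse′ (path₁ half) eb′ na eb″ ea″

    none-both-none : Half c (p ∷ q ∷ r ∷ []) → None x p → Both x q → ¬ None x r
    none-both-none half (na , nb) (ea′ , eb′) (na″ , nb″) = noP5′ (path₂ half) nb na nb″ ea′

    A-none-both : Half c (p ∷ q ∷ r ∷ []) → OnlyA x p → None x q → ¬ Both x r
    A-none-both half (ea , nb) (na′ , nb′) (ea″ , eb″) = noBull (path₂ half) nb ea eb″ na′

    both-none-B : Half c (p ∷ q ∷ r ∷ []) → Both x p → None x q → ¬ OnlyB x r
    both-none-B half (ea , eb) (na′ , nb′) (na″ , eb″) = noBull (path₁ half) nb′ ea eb″ na″

    both-both-none : Half c (p ∷ q ∷ r ∷ []) → Both x p → Both x q → ¬ None x r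
    both-both-none half (ea , eb) (ea′ , eb′) (na″ , nb″) = noHouse (path₂ half) eb ea nb″ ea′

    -- Here and in the next two lemmas x lies on the P₄ and the fifth vertex comes from the half
    -- graph: b₂ completes b₁ - a₁ - x - a₃ to a bull.
    A-both-both : Half c (p ∷ q ∷ r ∷ []) → OnlyA x p → Both x q → ¬ Both x r
    A-both-both ((pq ∷ pr ∷ []) ∷ (qr ∷ []) ∷ _ , rp ∷ _) (ea , nb) (ea′ , eb′) (ea″ , eb″) =
      noBull (p4 (E-sym rp) (E-sym ea) ea″ (N-sym nb) (Before.ba pr) (Before.aa pr))
        (N-sym (Before.bb pq)) (E-sym (Before.ab pq)) (E-sym eb′) (Before.ba qr)

    both-both-B : Half c (p ∷ q ∷ r ∷ []) → Both x p → Both x q → ¬ OnlyB x r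
    both-both-B ((pq ∷ pr ∷ []) ∷ (qr ∷ []) ∷ _ , _ ∷ _ ∷ rr ∷ []) (ea , eb) (ea′ , eb′) (na″ , eb″) =
      noBull (p4 rr (E-sym eb″) eb (N-sym na″) (N-sym (Before.ba pr)) (N-sym (Before.bb pr)))
        (Before.aa qr) (Before.ab qr) (E-sym ea′) (N-sym (Before.ba pq))

    both-none-both : Half c (p ∷ q ∷ r ∷ []) → Both x p → None x q → ¬ Both x r
    both-none-both ((pq ∷ pr ∷ []) ∷ (qr ∷ []) ∷ _ , _ ∷ rq ∷ _) (ea , eb) (na′ , nb′) (ea″ , eb″) =
      noHouse′ (p4 (E-sym rq) (Before.ab qr) (E-sym eb″) (Before.bb qr) (N-sym nb′) (N-sym na′))
        (Before.ab pq) (Before.aa pq) (Before.ab pr) (E-sym ea)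

  twinA-∃ : ∀ {x hs} → TwinA x hs → ∃ λ q → q ∈ hs × (OnlyB x q ⊎ Both x q)
  twinA-∃ (here s _)  = _ , here refl , s
  twinA-∃ (there _ t) = let q , q∈hs , s = twinA-∃ t in q , there q∈hs , s

  -- The status of x at p either extends the attachment to the tail or clashes with one or two later
  -- pairs.
  attach-∷ : ∀ {x p hs} → Half c (p ∷ hs) → Status x p → All (Status x) hs →
             Attachment x hs → Attachment x (p ∷ hs)
  attach-∷ {x} {p} {hs} half = go
    where
    at₁ : ∀ {q} → q ∈ hs → Half c (p ∷ q ∷ [])
    at₁ = before-right [] half

    later : ∀ {q r gs} → hs ≡ q ∷ gs → r ∈ gs → Half c (p ∷ q ∷ r ∷ [])
    later refl r∈gs = half-⊆ (refl ∷ refl ∷ from∈ r∈gs) half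

    go : Status x p → All (Status x) hs → Attachment x hs → Attachment x (p ∷ hs)
    go (none n) _ (anti ns)                          = anti (n ∷ ns)
    go (none n) _ (full (b ∷ b′ ∷ _))                = contradiction b′ (none-both-both (later refl (here refl)) n b)
    go (none n) _ (twinA t)                          = twinA (there n t)
    go (none n) _ (twinB (there a _))                = contradiction a (none-A (at₁ (here refl)) n)
    go (none n) _ (twinB (here (inj₁ a) _))          = contradiction a (none-A (at₁ (here refl)) n)
    -- A vertex complete to the last pair was read as a twin of its `b`; a `None` pair in front
    -- makes it a twin of its `a`.
    go (none n) _ (twinB (here (inj₂ b) []))         = twinA (there n (here (inj₂ b) []))
    go (none n) _ (twinB (here (inj₂ b) (n′ ∷ _)))   = contradiction n′ (none-both-none (later refl (here refl)) n b)
    go (onlyA a) _ (anti ns)                         = twinB (here (inj₁ a) ns)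
    go (onlyA a) _ (full (b ∷ b′ ∷ _))               = contradiction b′ (A-both-both (later refl (here refl)) a b)
    go (onlyA a) _ (twinA (here (inj₁ b) _))         = contradiction b (A-B (at₁ (here refl)) a)
    go (onlyA a) _ (twinA (here (inj₂ b) []))        = twinB (there a (here (inj₂ b) []))
    go (onlyA a) _ (twinA (here (inj₂ b) (b′ ∷ _)))  = contradiction b′ (A-B (at₁ (there (here refl))) a)
    go (onlyA a) _ (twinA (there n t)) with twinA-∃ t
    ... | _ , q∈ , inj₁ b = contradiction b (A-B (at₁ (there q∈)) a)
    ... | _ , q∈ , inj₂ b = contradiction b (A-none-both (later refl q∈) a n)
    go (onlyA a) _ (twinB t)                         = twinB (there a t)
    -- The two-pair exclusions force `OnlyB` on every later pair.
    go (onlyB b) ss _                                =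
      twinA (here (inj₁ b) (All.tabulate λ q∈ → stay (at₁ q∈) (All.lookup ss q∈)))
      where
      stay : ∀ {q} → Half c (p ∷ q ∷ []) → Status x q → OnlyB x q
      stay pq (none n)   = contradiction n (B-none pq b)
      stay pq (onlyA a)  = contradiction a (B-A pq b)
      stay pq (onlyB b′) = b′
      stay pq (both b′)  = contradiction b′ (B-both pq b)
    go (both b) _ (anti ns)                          = twinB (here (inj₂ b) ns)
    go (both b) _ (full bs)                          = full (b ∷ bs)
    go (both b) _ (twinA (here (inj₁ b′) bs))        = twinA (here (inj₂ b) (b′ ∷ bs))
    go (both b) _ (twinA (here (inj₂ b′) []))        = full (b ∷ b′ ∷ [])
    go (both b) _ (twinA (here (inj₂ b′) (b″ ∷ _)))  = contradiction b″ (both-both-B (later refl (here refl)) b b′)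
    go (both b) _ (twinA (there n t)) with twinA-∃ t
    ... | _ , q∈ , inj₁ b′ = contradiction b′ (both-none-B (later refl q∈) b n)
    ... | _ , q∈ , inj₂ b′ = contradiction b′ (both-none-both (later refl q∈) b n)
    go (both b) _ (twinB (there a _))                = contradiction a (both-A (at₁ (here refl)) b)
    go (both b) _ (twinB (here (inj₁ a) _))          = contradiction a (both-A (at₁ (here refl)) b)
    go (both b) _ (twinB (here (inj₂ b′) []))        = full (b ∷ b′ ∷ [])
    go (both b) _ (twinB (here (inj₂ b′) (n ∷ _)))   = contradiction n (both-both-none (later refl (here refl)) b b′)

  attachment : ∀ {x hs} → Half c hs → All (Status x) hs → Attachment x hs
  attachment half                  []       = anti []
  attachment half@(_ ∷ bs , _ ∷ rs) (s ∷ ss) = attach-∷ half s ss (attachment (bs , rs) ss)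

  -- The alternative in the complement arises only from two pairs, in `co-widen-right` and
  -- `co-widen-left`.
  Larger : List (V × V) → Set
  Larger hs = ∃ λ hs′ → length hs′ ≡ suc (length hs) × (Half c hs′ ⊎ Half (dual c) hs′)

  -- The vertices a and v fill the same position of a half graph and w tells them apart. The pair at
  -- this position thus shows w two different statuses, which together restrict the statuses of all
  -- other pairs.
  module Split (gs : List (V × V)) {a v b w : V} (hs : List (V × V))
    (halfᵃ : Half c (gs ++ (a , b) ∷ hs)) (halfᵛ : Half c (gs ++ (v , b) ∷ hs))
    (wa : E w a) (wv : N w v) where

    ab : E a b
    ab with r ∷ _ ← Allₚ.++⁻ʳ gs (proj₂ halfᵃ) = r

    vb : E v b
    vb with r ∷ _ ← Allₚ.++⁻ʳ gs (proj₂ halfᵛ) = r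

    w≢b : w ≢ b
    w≢b refl = E∩N (E-sym vb) wv

    a≢v : a ≢ v
    a≢v refl = E∩N wa wv

    gᵃ : ∀ {q} → q ∈ gs → Half c (q ∷ (a , b) ∷ [])
    gᵃ = before-left halfᵃ

    gᵛ : ∀ {q} → q ∈ gs → Half c (q ∷ (v , b) ∷ [])
    gᵛ = before-left halfᵛ

    hᵃ : ∀ {q} → q ∈ hs → Half c ((a , b) ∷ q ∷ [])
    hᵃ = before-right gs halfᵃ

    hᵛ : ∀ {q} → q ∈ hs → Half c ((v , b) ∷ q ∷ [])
    hᵛ = before-right gs halfᵛ

    -- No vertex of an earlier pair is adjacent to a, whereas w is; so w lies outside the pair.
    status-g : ∀ {q} → q ∈ gs → Status w q
    status-g q∈ with (before _ aa _ ba ∷ []) ∷ _ , _ ← gᵃ q∈ =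
      status (λ { refl → E∩N wa aa }) (λ { refl → E∩N wa ba })

    status-h : ∀ {q} → q ∈ hs → Status w q
    status-h q∈ with (before _ aa _ _ ∷ []) ∷ _ , _ ← hᵃ q∈ | (before ab′ _ _ _ ∷ []) ∷ _ , _ ← hᵛ q∈ =
      status (λ { refl → E∩N wa (N-sym aa) }) (λ { refl → E∩N (E-sym ab′) wv })

    module _ (wb : N w b) where
      left-A : ∀ {q} → q ∈ gs → OnlyA w q
      left-A q∈ with status-g q∈
      ... | none n  = contradiction (wa , wb) (none-A (gᵃ q∈) n)
      ... | onlyA s = s
      ... | onlyB s = contradiction (wa , wb) (B-A (gᵃ q∈) s)
      ... | both s  = contradiction (wa , wb) (both-A (gᵃ q∈) s)

      right-none-or-both : ∀ {q} → q ∈ hs → None w q ⊎ Both w q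
      right-none-or-both q∈ with status-h q∈
      ... | none s  = inj₁ s
      ... | onlyA s = contradiction s (none-A (hᵛ q∈) (wv , wb))
      ... | onlyB s = contradiction s (A-B (hᵃ q∈) (wa , wb))
      ... | both s  = inj₂ s

      -- Suppose a and v are adjacent. With an earlier pair, b completes the path v - a - w - a′ to
      -- a house; with a later one, v completes w - a - b′ - a′ to a bull. This is where a second
      -- pair of the half graph is used.
      a≁v : All (None w) hs → ∀ {q} → q ∈ gs ⊎ q ∈ hs → N a v
      a≁v ns q∈ with E∪N a≢v
      ... | inj₂ av = av
      a≁v ns (inj₁ q∈) | inj₁ av
        with ea , _ ← left-A q∈
        with (before abᵃ aaᵃ _ _ ∷ []) ∷ _ , _ ← gᵃ q∈ | (before _ aaᵛ _ _ ∷ []) ∷ _ , _ ← gᵛ q∈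
        = ⊥-elim (noHouse (p4 (E-sym av) (E-sym wa) ea (N-sym wv) (N-sym aaᵛ) (N-sym aaᵃ))
            (E-sym vb) (E-sym ab) (N-sym wb) (E-sym abᵃ))
      a≁v ns (inj₂ q∈) | inj₁ av
        with na , nb ← All.lookup ns q∈
        with (before abᵃ aaᵃ _ _ ∷ []) ∷ _ , _ ∷ r ∷ [] ← hᵃ q∈ | (before abᵛ aaᵛ _ _ ∷ []) ∷ _ , _ ← hᵛ q∈
        = ⊥-elim (noBull (p4 wa abᵃ (E-sym r) nb na aaᵃ)
            (N-sym wv) (E-sym av) abᵛ aaᵛ)

      -- The vertex w becomes a new `b` matched with a, while v takes over the old partner of a.
      widen : All (None w) hs → N a v → Half c (gs ++ (a , w) ∷ (v , b) ∷ hs)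
      widen ns av = half-insert gs halfᵛ (E-sym wa)
        (All.tabulate left) (before ab av wb wv ∷ All.tabulate right)
        where
        left : ∀ {q} → q ∈ gs → Before c q (a , w)
        left q∈ with ea , nb ← left-A q∈ | (before _ aa _ ba ∷ []) ∷ _ , _ ← gᵃ q∈ =
          before (E-sym ea) aa (N-sym nb) ba

        right : ∀ {q} → q ∈ hs → Before c (a , w) q
        right q∈ with na , nb ← All.lookup ns q∈ | (before abᵃ aa _ _ ∷ []) ∷ _ , _ ← hᵃ q∈ =
          before abᵃ aa nb na

      module _ {p} (s : Both w p) where
        -- If w is complete to a later pair p, then this and the next two lemmas exclude a further
        -- pair in each possible position, so the half graph has just two pairs.
        right-both-left : ∀ {q} → q ∈ gs → ¬ p ∈ hs
        right-both-left q∈ p∈ =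
          A-none-both (half-⊆ (++⁺ (from∈ q∈) (refl ∷ from∈ p∈)) halfᵛ) (left-A q∈) (wv , wb) s

        right-both-prev : ∀ {q} → q ∈ hs → ¬ (q ∷ p ∷ []) ⊆ hs
        right-both-prev q∈ τ with right-none-or-both q∈
        ... | inj₁ n = A-none-both (half-⊆ (++⁺ (minimum gs) (refl ∷ τ)) halfᵃ) (wa , wb) n s
        ... | inj₂ t = none-both-both (half-⊆ (++⁺ (minimum gs) (refl ∷ τ)) halfᵛ) (wv , wb) t s

        right-both-next : ∀ {q} → q ∈ hs → ¬ (p ∷ q ∷ []) ⊆ hs
        right-both-next q∈ τ with right-none-or-both q∈
        ... | inj₁ n = none-both-none (half-⊆ (++⁺ (minimum gs) (refl ∷ τ)) halfᵛ) (wv , wb) s n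
        ... | inj₂ t = none-both-both (half-⊆ (++⁺ (minimum gs) (refl ∷ τ)) halfᵛ) (wv , wb) s t

    module _ (wb : E w b) where
      left-none-or-both : ∀ {q} → q ∈ gs → None w q ⊎ Both w q
      left-none-or-both q∈ with status-g q∈
      ... | none s  = inj₁ s
      ... | onlyA s = contradiction (wv , wb) (A-B (gᵛ q∈) s)
      ... | onlyB s = contradiction (wa , wb) (B-both (gᵃ q∈) s)
      ... | both s  = inj₂ s

      right-B : ∀ {q} → q ∈ hs → OnlyB w q
      right-B q∈ with status-h q∈
      ... | none s  = contradiction s (B-none (hᵛ q∈) (wv , wb))
      ... | onlyA s = contradiction s (B-A (hᵛ q∈) (wv , wb))
      ... | onlyB s = s
      ... | both s  = contradiction s (B-both (hᵛ q∈) (wv , wb))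

      -- Here w could replace a as well, contrary to its choice outside the twin class. The list
      -- arises by dropping `(a , b)` and inserting `(w , b)`.
      twin : All (None w) gs → Half c (gs ++ (w , b) ∷ hs)
      twin ns = half-insert gs (half-⊆ (++⁺ ⊆-refl (_ ∷ʳ ⊆-refl)) halfᵃ) wb
        (All.tabulate left) (All.tabulate right)
        where
        left : ∀ {q} → q ∈ gs → Before c q (w , b)
        left q∈ with na , nb ← All.lookup ns q∈ | (before abᵃ _ bb _ ∷ []) ∷ _ , _ ← gᵃ q∈ =
          before abᵃ (N-sym na) bb (N-sym nb)

        right : ∀ {q} → q ∈ hs → Before c (w , b) q
        right q∈ with na , eb ← right-B q∈ | (before _ _ bb ba ∷ []) ∷ _ , _ ← hᵃ q∈ =
          before eb na bb ba

      module _ {p} (s : Both w p) where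
        left-both-right : ∀ {q} → q ∈ hs → ¬ p ∈ gs
        left-both-right q∈ p∈ =
          both-both-B (half-⊆ (++⁺ (from∈ p∈) (refl ∷ from∈ q∈)) halfᵃ) s (wa , wb) (right-B q∈)

        left-both-prev : ∀ {q} → q ∈ gs → ¬ (q ∷ p ∷ []) ⊆ gs
        left-both-prev q∈ τ with left-none-or-both q∈
        ... | inj₁ n = none-both-both (half-⊆ (++⁺ τ (refl ∷ minimum hs)) halfᵃ) n s (wa , wb)
        ... | inj₂ t = both-both-B (half-⊆ (++⁺ τ (refl ∷ minimum hs)) halfᵛ) t s (wv , wb)

        left-both-next : ∀ {q} → q ∈ gs → ¬ (p ∷ q ∷ []) ⊆ gs
        left-both-next q∈ τ with left-none-or-both q∈
        ... | inj₁ n = both-none-both (half-⊆ (++⁺ τ (refl ∷ minimum hs)) halfᵃ) s n (wa , wb)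
        ... | inj₂ t = both-both-B (half-⊆ (++⁺ τ (refl ∷ minimum hs)) halfᵛ) s t (wv , wb)

  -- The path b − a − b′ − a′ with v a twin of a, and w adjacent to a, b′, a′ only.
  co-widen-right : ∀ {a v b w p} → Half c ((a , b) ∷ p ∷ []) → Half c ((v , b) ∷ p ∷ []) →
                   E w a → N w v → N w b → Both w p → Larger ((a , b) ∷ p ∷ [])
  co-widen-right {a} {v} {b} {w} {a′ , b′}
    ((before ab′ aa′ bb′ ba′ ∷ []) ∷ _ , ab ∷ a′b′ ∷ [])
    ((before vb′ va′ _ _ ∷ []) ∷ _ , vb ∷ _)
    wa wv wb (wa′ , wb′) =
    -- The sets a′, w, b′ and a, v, b are cliques, hence the two sides of an O₃ in the complement.
    (a′ , a) ∷ (w , v) ∷ (b′ , b) ∷ [] , refl , inj₂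
      ( ( before (N-sym va′) (E-sym wa′) av (E-sym wa)
        ∷ before (N-sym ba′) a′b′ ab ab′ ∷ [])
        ∷ (before wb wb′ vb vb′ ∷ []) ∷ [] ∷ []
      , N-sym aa′ ∷ wv ∷ N-sym bb′ ∷ [])
    where
    av : E a v
    av with E∪N {a} {v} (λ { refl → E∩N wa wv })
    ... | inj₁ av = av
    -- Otherwise b′ completes the path v - b - a - w to a house.
    ... | inj₂ av = ⊥-elim (noHouse′ (p4 vb (E-sym ab) (E-sym wa) (N-sym av) (N-sym wv) (N-sym wb))
                      (E-sym vb′) (N-sym bb′) (E-sym ab′) (E-sym wb′))

  -- The path b′ − a′ − b − a with v a twin of a, and w adjacent to all four of its vertices.
  co-widen-left : ∀ {a v b w p} → Half c (p ∷ (a , b) ∷ []) → Half c (p ∷ (v , b) ∷ []) →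
                  E w a → N w v → E w b → Both w p → Larger (p ∷ (a , b) ∷ [])
  co-widen-left {a} {v} {b} {w} {a′ , b′}
    ((before a′b a′a b′b b′a ∷ []) ∷ _ , a′b′ ∷ ab ∷ [])
    ((before _ a′v _ b′v ∷ []) ∷ _ , _ ∷ vb ∷ [])
    wa wv wb (wa′ , wb′) =
    (v , w) ∷ (a , a′) ∷ (b , b′) ∷ [] , refl , inj₂
      ( ( before (N-sym a′v) (E-sym av) wa′ wa
        ∷ before (N-sym b′v) vb wb′ wb ∷ [])
        ∷ (before (N-sym b′a) ab a′b′ a′b ∷ []) ∷ [] ∷ []
      , N-sym wv ∷ N-sym a′a ∷ N-sym b′b ∷ [])
    where
    av : E a v
    av with E∪N {a} {v} (λ { refl → E∩N wa wv })
    ... | inj₁ av = av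
    -- Otherwise a completes the path v - b - w - b′ to a bull.
    ... | inj₂ av = ⊥-elim (noBull (p4 vb (E-sym wb) wb′ (N-sym wv) (N-sym b′v) (N-sym b′b))
                      av ab (E-sym wa) (N-sym b′a))

  enlarge-split : ∀ gs {a v b w} hs → 2 ≤ length (gs ++ (a , b) ∷ hs) →
                  Half c (gs ++ (a , b) ∷ hs) → Half c (gs ++ (v , b) ∷ hs) →
                  E w a → N w v → ¬ Half c (gs ++ (w , b) ∷ hs) → Larger (gs ++ (a , b) ∷ hs)
  enlarge-split gs {a} {v} {b} {w} hs two halfᵃ halfᵛ wa wv ¬twin with E∪N (Split.w≢b gs hs halfᵃ halfᵛ wa wv)
  enlarge-split gs {a} {v} {b} {w} hs two halfᵃ halfᵛ wa wv ¬twin | inj₂ wb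
    with All-or-∃ (All.tabulate (Split.right-none-or-both gs hs halfᵃ halfᵛ wa wv wb))
  ... | inj₁ ns = gs ++ (a , w) ∷ (v , b) ∷ hs , length-widen gs ,
                  inj₁ (S.widen wb ns (S.a≁v wb ns (proj₂ (other gs hs two))))
    where
    module S = Split gs hs halfᵃ halfᵛ wa wv

    length-widen : ∀ gs → length (gs ++ (a , w) ∷ (v , b) ∷ hs) ≡ suc (length (gs ++ (a , b) ∷ hs))
    length-widen []       = refl
    length-widen (_ ∷ gs) = cong suc (length-widen gs)

    other : ∀ gs hs → 2 ≤ length (gs ++ (a , b) ∷ hs) → ∃ λ q → q ∈ gs ⊎ q ∈ hs
    other (q ∷ _) _       _        = q , inj₁ (here refl)
    other []      (q ∷ _) _        = q , inj₂ (here refl)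
    other []      []      (s≤s ())
  ... | inj₂ (p , p∈hs , s) with hs₁ , hs₂ , refl ← ∈-∃++ p∈hs = go gs hs₁ hs₂ halfᵃ halfᵛ
    where
    go : ∀ gs hs₁ hs₂ → Half c (gs ++ (a , b) ∷ hs₁ ++ p ∷ hs₂) → Half c (gs ++ (v , b) ∷ hs₁ ++ p ∷ hs₂) →
         Larger (gs ++ (a , b) ∷ hs₁ ++ p ∷ hs₂)
    go []         []         []         hᵃ hᵛ = co-widen-right hᵃ hᵛ wa wv wb s
    go gs@(_ ∷ _) hs₁        hs₂        hᵃ hᵛ =
      ⊥-elim (Split.right-both-left gs _ hᵃ hᵛ wa wv wb s (here refl) (∈-++⁺ʳ hs₁ (here refl)))
    go []         (_ ∷ hs₁)  hs₂        hᵃ hᵛ =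
      ⊥-elim (Split.right-both-prev [] _ hᵃ hᵛ wa wv wb s (here refl) (refl ∷ ++⁺ (minimum hs₁) (refl ∷ minimum hs₂)))
    go []         []         (_ ∷ hs₂)  hᵃ hᵛ =
      ⊥-elim (Split.right-both-next [] _ hᵃ hᵛ wa wv wb s (there (here refl)) (refl ∷ refl ∷ minimum hs₂))
  enlarge-split gs {a} {v} {b} {w} hs two halfᵃ halfᵛ wa wv ¬twin | inj₁ wb
    with All-or-∃ (All.tabulate (Split.left-none-or-both gs hs halfᵃ halfᵛ wa wv wb))
  ... | inj₁ ns = contradiction (Split.twin gs hs halfᵃ halfᵛ wa wv wb ns) ¬twin
  ... | inj₂ (p , p∈gs , s) with gs₁ , gs₂ , refl ← ∈-∃++ p∈gs = go gs₁ gs₂ hs halfᵃ halfᵛ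
    where
    go : ∀ gs₁ gs₂ hs → Half c ((gs₁ ++ p ∷ gs₂) ++ (a , b) ∷ hs) → Half c ((gs₁ ++ p ∷ gs₂) ++ (v , b) ∷ hs) →
         Larger ((gs₁ ++ p ∷ gs₂) ++ (a , b) ∷ hs)
    go []         []         []         hᵃ hᵛ = co-widen-left hᵃ hᵛ wa wv wb s
    go gs₁        gs₂        hs@(_ ∷ _) hᵃ hᵛ =
      ⊥-elim (Split.left-both-right (gs₁ ++ p ∷ gs₂) hs hᵃ hᵛ wa wv wb s (here refl) (∈-++⁺ʳ gs₁ (here refl)))
    go (g ∷ gs₁)  gs₂        []         hᵃ hᵛ =
      ⊥-elim (Split.left-both-prev (g ∷ gs₁ ++ p ∷ gs₂) [] hᵃ hᵛ wa wv wb s (here refl)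
        (refl ∷ ++⁺ (minimum gs₁) (refl ∷ minimum gs₂)))
    go []         (g ∷ gs₂)  []         hᵃ hᵛ =
      ⊥-elim (Split.left-both-next (p ∷ g ∷ gs₂) [] hᵃ hᵛ wa wv wb s (there (here refl)) (refl ∷ refl ∷ minimum gs₂))

  -- Primality is applied to the class of all vertices that can replace a. It contains a and v but
  -- not b, since b is not adjacent to itself.
  enlarge-twin : Prime c → ∀ gs {a v b} hs → 2 ≤ length (gs ++ (a , b) ∷ hs) → a ≢ v →
                 Half c (gs ++ (a , b) ∷ hs) → Half c (gs ++ (v , b) ∷ hs) → Larger (gs ++ (a , b) ∷ hs)
  enlarge-twin prime gs {a} {v} {b} hs two a≢v halfᵃ halfᵛ =
    let w , a′ , v′ , ¬qw , qa , qv , wa , wv =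
          prime (λ x → half? c (gs ++ (x , b) ∷ hs)) {t = b} halfᵃ halfᵛ a≢v ¬qb
    in  resize (enlarge-split gs hs (subst (2 ≤_) (length-≡ gs) two) qa qv wa wv ¬qw)
    where
    ¬qb : ¬ Half c (gs ++ (b , b) ∷ hs)
    ¬qb (_ , rs) with r ∷ _ ← Allₚ.++⁻ʳ gs rs = E-irrefl r

    length-≡ : ∀ gs {p q : V × V} → length (gs ++ p ∷ hs) ≡ length (gs ++ q ∷ hs)
    length-≡ []       = refl
    length-≡ (_ ∷ gs) = cong suc (length-≡ gs)

    -- Primality may single out a member a′ other than a; `Larger` depends on the list only through
    -- its length.
    resize : ∀ {a′} → Larger (gs ++ (a′ , b) ∷ hs) → Larger (gs ++ (a , b) ∷ hs)
    resize (hs′ , eq , half) = hs′ , trans eq (cong suc (length-≡ gs)) , half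

  enlarge-attached : Prime c → ∀ {hs x} → 2 ≤ length hs → Half c hs → All (Status x) hs →
    (∀ {p} → p ∈ hs → x ≢ proj₁ p × x ≢ proj₂ p) →
    ¬ All (None x) hs → ¬ All (Both x) hs → Larger hs
  enlarge-attached prime {hs} {x} two half ss x∉ mixed₁ mixed₂ with attachment half ss
  ... | anti ns = contradiction ns mixed₁
  ... | full bs = contradiction bs mixed₂
  ... | twinA t with gs , a , b , ks , refl , half′ ← replaceA half t =
    enlarge-twin prime gs ks two (λ { refl → proj₁ (x∉ (∈-++⁺ʳ gs (here refl))) refl }) half half′
  ... | twinB t with gs , a , b , ks , refl , half′ ← replaceB half t =
    -- Reversal turns a twin of a `b` into a twin of an `a`.
    let hs′ , eq , bigger = enlarge-twin prime (rev ks) (rev gs)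
          (subst (2 ≤_) (trans (sym (length-rev hs)) (cong length (rev-++ gs (a , b) ks))) two)
          (λ { refl → proj₂ (x∉ (∈-++⁺ʳ gs (here refl))) refl })
          (subst (Half c) (rev-++ gs (a , b) ks) (half-rev half))
          (subst (Half c) (rev-++ gs (a , x) ks) (half-rev half′))
    in  hs′ , trans eq (cong suc (trans (cong length (sym (rev-++ gs (a , b) ks))) (length-rev hs))) , bigger

-- Decidable predicates as subsets

module _ {n : ℕ} {Q : Fin n → Set} (Q? : Unary.Decidable Q) where

  ⟦_⟧ : Subset n
  ⟦_⟧ = Vec.tabulate (does ∘ Q?)

  ∈⟦⟧⁺ : ∀ {v} → Q v → v ∈ˢ ⟦_⟧
  ∈⟦⟧⁺ {v} q = Vecₚ.lookup⇒[]= v _ (trans (Vecₚ.lookup∘tabulate (does ∘ Q?) v) (dec-true (Q? v) q))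

  ∈⟦⟧⁻ : ∀ {v} → v ∈ˢ ⟦_⟧ → Q v
  ∈⟦⟧⁻ {v} v∈ with Q? v | trans (sym (Vecₚ.lookup∘tabulate (does ∘ Q?) v)) (Vecₚ.[]=⇒lookup v∈)
  ... | yes q | _ = q

-- Isomorphisms

≅-fromEmbedding : ∀ {V W} {G : Graph V} {H : Graph W} (f : W → V) → Injective _≡_ _≡_ f →
                  (∀ v → ∃ λ w → f w ≡ v) → (∀ s t → Adj G (f s) (f t) ⇔ Adj H s t) → G ≅ H
≅-fromEmbedding {G = G} {H} f inj surj iff = record
  { bijection = mk↔ₛ′ (proj₁ ∘ surj) f (λ w → inj (proj₂ (surj (f w)))) (proj₂ ∘ surj)
  ; adjacency = λ u v → subst₂ (λ s t → Adj G s t ⇔ Adj H (proj₁ (surj u)) (proj₁ (surj v)))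
      (proj₂ (surj u)) (proj₂ (surj v)) (iff (proj₁ (surj u)) (proj₁ (surj v)))
  }

colouring : ∀ {n} → Graph (Fin n) → Colouring (Fin n)
colouring G = record
  { E        = Adj G
  ; N        = Adj (complement G)
  ; E-sym    = Graph.~-sym G
  ; N-sym    = Graph.~-sym (complement G)
  ; E-irrefl = Graph.~-irrefl G refl
  ; N-irrefl = Graph.~-irrefl (complement G) refl
  ; E∩N      = λ e (_ , ¬e) → ¬e e
  ; E∪N      = λ {u} {v} u≢v → decide u≢v (Graph._~?_ G u v)
  ; E?       = Graph._~?_ G
  ; N?       = Graph._~?_ (complement G)
  }
  where
  decide : ∀ {u v} → u ≢ v → Dec (Adj G u v) → Adj G u v ⊎ Adj (complement G) u v
  decide u≢v (yes e) = inj₁ e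
  decide u≢v (no ¬e) = inj₂ (u≢v , ¬e)

module Pattern {n : ℕ} (G : Graph (Fin n)) {W : Set} (H : Graph W) (label : Fin 5 ↔ W) where
  open Colouring (colouring G)
  open Inverse label using (to; from; strictlyInverseˡ; strictlyInverseʳ)

  Coloured : Bool → Fin n → Fin n → Set
  Coloured true  = E
  Coloured false = N

  -- The required colour is computed from the decision procedure of H, so for a concrete H the type
  -- `Pattern` reduces to ten facts `E` or `N`.
  Entry : Vec (Fin n) 5 → Fin 5 → Fin 5 → Set
  Entry vs i j = Coloured (does (Graph._~?_ H (to i) (to j))) (Vec.lookup vs i) (Vec.lookup vs j)

  Pattern : Vec (Fin n) 5 → Set
  Pattern vs = Entry vs 0F 1F × Entry vs 0F 2F × Entry vs 0F 3F × Entry vs 0F 4F ×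
               Entry vs 1F 2F × Entry vs 1F 3F × Entry vs 1F 4F ×
               Entry vs 2F 3F × Entry vs 2F 4F × Entry vs 3F 4F

  entry : ∀ vs → Pattern vs → ∀ i j → i Fin.< j → Entry vs i j
  entry _ (e , _)                                    0F 1F _ = e
  entry _ (_ , e , _)                                0F 2F _ = e
  entry _ (_ , _ , e , _)                            0F 3F _ = e
  entry _ (_ , _ , _ , e , _)                        0F 4F _ = e
  entry _ (_ , _ , _ , _ , e , _)                    1F 2F _ = e
  entry _ (_ , _ , _ , _ , _ , e , _)                1F 3F _ = e
  entry _ (_ , _ , _ , _ , _ , _ , e , _)            1F 4F _ = e
  entry _ (_ , _ , _ , _ , _ , _ , _ , e , _)        2F 3F _ = e
  entry _ (_ , _ , _ , _ , _ , _ , _ , _ , e , _)    2F 4F _ = e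
  entry _ (_ , _ , _ , _ , _ , _ , _ , _ , _ , e)    3F 4F _ = e
  entry _ _ 1F 1F (s≤s ())
  entry _ _ 2F 1F (s≤s ())
  entry _ _ 2F 2F (s≤s (s≤s ()))
  entry _ _ 3F 1F (s≤s ())
  entry _ _ 3F 2F (s≤s (s≤s ()))
  entry _ _ 3F 3F (s≤s (s≤s (s≤s ())))
  entry _ _ 4F 1F (s≤s ())
  entry _ _ 4F 2F (s≤s (s≤s ()))
  entry _ _ 4F 3F (s≤s (s≤s (s≤s ())))
  entry _ _ 4F 4F (s≤s (s≤s (s≤s (s≤s ()))))

  module _ (vs : Vec (Fin n) 5) (pat : Pattern vs) where

    distinct : ∀ i j → i Fin.< j → Vec.lookup vs i ≢ Vec.lookup vs j
    distinct i j i<j eq with does (Graph._~?_ H (to i) (to j)) | entry vs pat i j i<j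
    ... | true  | e = Graph.~-irrefl G eq e
    ... | false | e = Graph.~-irrefl (complement G) eq e

    lookup-injective : Injective _≡_ _≡_ (Vec.lookup vs)
    lookup-injective {i} {j} eq with Finₚ.<-cmp i j
    ... | tri< i<j _ _ = contradiction eq (distinct i j i<j)
    ... | tri≈ _ i≡j _ = i≡j
    ... | tri> _ _ j<i = contradiction (sym eq) (distinct j i j<i)

    adjacent-< : ∀ i j → i Fin.< j → Adj G (Vec.lookup vs i) (Vec.lookup vs j) ⇔ Adj H (to i) (to j)
    adjacent-< i j i<j with Graph._~?_ H (to i) (to j) | entry vs pat i j i<j
    ... | yes h | e = mk⇔ (λ _ → h) (λ _ → e)
    ... | no ¬h | e = mk⇔ (λ g → ⊥-elim (E∩N g e)) (⊥-elim ∘ ¬h)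

    adjacent : ∀ i j → Adj G (Vec.lookup vs i) (Vec.lookup vs j) ⇔ Adj H (to i) (to j)
    adjacent i j with Finₚ.<-cmp i j
    ... | tri< i<j _ _  = adjacent-< i j i<j
    ... | tri≈ _ refl _ = mk⇔ (⊥-elim ∘ E-irrefl) (⊥-elim ∘ Graph.~-irrefl H refl)
    ... | tri> _ _ j<i  = mk⇔ (Graph.~-sym H ∘ Equivalence.to (adjacent-< j i j<i) ∘ E-sym)
                              (E-sym ∘ Equivalence.from (adjacent-< j i j<i) ∘ Graph.~-sym H)

    place : W → Fin n
    place = Vec.lookup vs ∘ from

    place-injective : Injective _≡_ _≡_ place
    place-injective {s} {t} eq =
      trans (sym (strictlyInverseˡ s)) (trans (cong to (lookup-injective eq)) (strictlyInverseˡ t))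

    place-adjacent : ∀ s t → Adj G (place s) (place t) ⇔ Adj H s t
    place-adjacent s t = subst₂ (λ s′ t′ → Adj G (place s) (place t) ⇔ Adj H s′ t′)
      (strictlyInverseˡ s) (strictlyInverseˡ t) (adjacent (from s) (from t))

    place-onto : ∀ {v} → (∃ λ i → Vec.lookup vs i ≡ v) → ∃ λ w → place w ≡ v
    place-onto (i , eq) = to i , trans (cong (Vec.lookup vs) (strictlyInverseʳ i)) eq

    ≅-pattern : (∀ v → ∃ λ i → Vec.lookup vs i ≡ v) → G ≅ H
    ≅-pattern surj = ≅-fromEmbedding place place-injective (place-onto ∘ surj) place-adjacent

    induced-pattern : ∃ λ X → induced G X ≅ H
    induced-pattern = ⟦ hit? ⟧ , ≅-fromEmbedding
      (λ w → place w , ∈⟦⟧⁺ hit? (from w , refl))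
      (place-injective ∘ cong proj₁)
      -- Vertices of the induced subgraph carry membership proofs, which are unique.
      (λ (v , v∈) → map₂ (λ { refl → cong (place _ ,_) (VecWithKₚ.[]=-irrelevant _ v∈) }) (place-onto (∈⟦⟧⁻ hit? v∈)))
      place-adjacent
      where
      hit? : Unary.Decidable (λ v → ∃ λ i → Vec.lookup vs i ≡ v)
      hit? v = Finₚ.any? λ i → Vec.lookup vs i Finₚ.≟ v

Fin5↔BullVertex : Fin 5 ↔ BullVertex
Fin5↔BullVertex = mk↔ₛ′
  (λ { 0F → x₁ ; 1F → x₂ ; 2F → x₃ ; 3F → y ; 4F → z })
  (λ { x₁ → 0F ; x₂ → 1F ; x₃ → 2F ; y → 3F ; z → 4F })
  (λ { x₁ → refl ; x₂ → refl ; x₃ → refl ; y → refl ; z → refl })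
  (λ { 0F → refl ; 1F → refl ; 2F → refl ; 3F → refl ; 4F → refl })

restrict : ∀ {n} (G : Graph (Fin n)) → Free ((-, P 5) ∷ (-, complement (P 5)) ∷ (-, bull) ∷ []) G →
           Restricted (colouring G)
restrict G (noP5 ∷ noHouse ∷ noBull ∷ []) = record
  { noP5 = λ { {p} {q} {r} {s} {x} (p4 pq qr rs pr ps qs) xp xq xr xs →
      noP5 (Pattern.induced-pattern G (P 5) (↔-id _) (x ∷ p ∷ q ∷ r ∷ s ∷ [])
        (xp , xq , xr , xs , pq , pr , ps , qr , qs , rs)) }
  ; noBull = λ { {p} {q} {r} {s} {x} (p4 pq qr rs pr ps qs) xp xq xr xs →
      -- The triangle is q, r, x, and the horns p and s hang on q and r.
      noBull (Pattern.induced-pattern G bull Fin5↔BullVertex (q ∷ r ∷ x ∷ p ∷ s ∷ [])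
        (qr , E-sym xq , E-sym pq , qs , E-sym xr , N-sym pr , rs , xp , xs , ps)) }
  ; noHouse = λ { {p} {q} {r} {s} {x} (p4 pq qr rs pr ps qs) xp xq xr xs →
      -- The listed order is the path x - r - p - s - q of the complement.
      noHouse (Pattern.induced-pattern G (complement (P 5)) (↔-id _) (x ∷ r ∷ p ∷ s ∷ q ∷ [])
        (xr , xp , xs , xq , N-sym pr , rs , E-sym qr , ps , pq , N-sym qs)) }
  }
  where
  open Colouring (colouring G)

-- The case of an induced C₅

Pentagon : ∀ {V} → Colouring V → V → V → V → V → V → Set
Pentagon c x p q r s = P4 c p q r s × E x p × N x q × N x r × E x s
  where open Colouring c

Pentagon? : ∀ {V} (c : Colouring V) x p q r s → Dec (Pentagon c x p q r s)
Pentagon? c x p q r s = P4? c p q r s ×-dec E? x p ×-dec N? x q ×-dec N? x r ×-dec E? x s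
  where open Colouring c

module Pentagons {V : Set} (c : Colouring V) (restricted : Restricted c) (prime : Prime c) where
  open Colouring c
  open Restricted restricted

  rotate : ∀ {a p q r s} → Pentagon c a p q r s → Pentagon c p q r s a
  rotate (p4 pq qr rs pr ps qs , ap , aq , ar , as) =
    p4 qr rs (E-sym as) qs (N-sym aq) (N-sym ar) , pq , pr , ps , E-sym ap

  path-qrsa : ∀ {a p q r s} → Pentagon c a p q r s → P4 c q r s a
  path-qrsa = proj₁ ∘ rotate

  path-sapq : ∀ {a p q r s} → Pentagon c a p q r s → P4 c s a p q
  path-sapq = proj₁ ∘ rotate ∘ rotate ∘ rotate

  path-apqr : ∀ {a p q r s} → Pentagon c a p q r s → P4 c a p q r
  path-apqr = proj₁ ∘ rotate ∘ rotate ∘ rotate ∘ rotate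

  path-rqpa : ∀ {a p q r s} → Pentagon c a p q r s → P4 c r q p a
  path-rqpa = P4-reverse ∘ path-apqr

  -- Of the sixteen ways in which w can meet p, q, r, s, fifteen give a forbidden subgraph on w and
  -- four vertices of one of the two cycles.
  pentagon-twin : ∀ {a v p q r s w} → Pentagon c a p q r s → Pentagon c v p q r s → E w a → N w v →
                  Pentagon c w p q r s
  pentagon-twin {p = p} {q} {r} {s} {w} pentᵃ@(path , ap , aq , ar , as) pentᵛ@(_ , vp , vq , vr , vs) wa wv
    with E∪N {w} {p} (λ { refl → E∩N (E-sym vp) wv })
       | E∪N {w} {q} (λ { refl → E∩N wa (N-sym aq) })
       | E∪N {w} {r} (λ { refl → E∩N wa (N-sym ar) })
       | E∪N {w} {s} (λ { refl → E∩N (E-sym vs) wv })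
  ... | inj₁ wp | inj₂ wq | inj₂ wr | inj₁ ws = path , wp , wq , wr , ws
  ... | inj₁ wp | inj₁ wq | inj₂ wr | inj₁ ws = ⊥-elim (noBull (path-rqpa pentᵛ) wr wq wp wv)
  ... | inj₁ wp | inj₂ wq | inj₁ wr | inj₁ ws = ⊥-elim (noBull (path-qrsa pentᵛ) wq wr ws wv)
  ... | inj₁ wp | inj₁ wq | inj₁ wr | inj₁ ws = ⊥-elim (noHouse′ (path-sapq pentᵛ) ws wv wp wq)
  ... | inj₂ wp | inj₂ wq | inj₂ wr | _       = ⊥-elim (noP5′ (path-rqpa pentᵃ) wr wq wp wa)
  ... | inj₂ wp | inj₂ wq | inj₁ wr | _       = ⊥-elim (noP5 (path-rqpa pentᵛ) wr wq wp wv)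
  ... | inj₂ wp | inj₁ wq | inj₁ wr | _       = ⊥-elim (noHouse (path-rqpa pentᵃ) wr wq wp wa)
  ... | inj₂ wp | inj₁ wq | inj₂ wr | inj₁ ws = ⊥-elim (noHouse′ (path-qrsa pentᵃ) wq wr ws wa)
  ... | inj₂ wp | inj₁ wq | inj₂ wr | inj₂ ws = ⊥-elim (noP5 (path-qrsa pentᵛ) wq wr ws wv)
  ... | inj₁ wp | inj₂ wq | inj₂ wr | inj₂ ws = ⊥-elim (noP5′ (path-qrsa pentᵃ) wq wr ws wa)
  ... | inj₁ wp | inj₁ wq | inj₂ wr | inj₂ ws = ⊥-elim (noP5 (path-qrsa pentᵛ) wq wr ws wv)
  ... | inj₁ wp | inj₁ wq | inj₁ wr | inj₂ ws = ⊥-elim (noHouse (path-qrsa pentᵃ) wq wr ws wa)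
  ... | inj₁ wp | inj₂ wq | inj₁ wr | inj₂ ws = ⊥-elim (noHouse′ (path-rqpa pentᵃ) wr wq wp wa)

  -- Primality is applied to the vertices that close the path p - q - r - s to a C₅; by
  -- `pentagon-twin` a vertex mixed on this set would belong to it.
  pentagon-twin-≡ : ∀ {a v p q r s} → Pentagon c a p q r s → Pentagon c v p q r s → ¬ a ≢ v
  pentagon-twin-≡ {p = p} {q} {r} {s} pentᵃ pentᵛ a≢v =
    let w , a′ , v′ , ¬qw , qa , qv , wa , wv =
          prime (λ x → Pentagon? c x p q r s) {t = p} pentᵃ pentᵛ a≢v (λ (_ , pp , _) → E-irrefl pp)
    in  ¬qw (pentagon-twin qa qv wa wv)

  record Outside (x a p q r s : V) : Set where
    constructor outside
    field
      x≢a : x ≢ a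
      x≢p : x ≢ p
      x≢q : x ≢ q
      x≢r : x ≢ r
      x≢s : x ≢ s

  -- One step around the cycle: otherwise x would be a twin of a vertex of the cycle.
  pentagon-step : ∀ {x a p q r s} → Pentagon c a p q r s → Outside x a p q r s → E x a → E x p
  pentagon-step {x} {a} {p} {q} {r} {s} pent (outside x≢a x≢p x≢q x≢r x≢s) xa
    with pqrs , ap , aq , ar , as ← pent
    with E∪N x≢p | E∪N x≢q | E∪N x≢r | E∪N x≢s
  ... | inj₁ xp | _       | _       | _       = xp
  ... | inj₂ xp | inj₂ xq | inj₂ xr | inj₂ xs = ⊥-elim (noP5 (path-apqr pent) xa xp xq xr)
  ... | inj₂ xp | inj₂ xq | inj₂ xr | inj₁ xs = ⊥-elim (noP5′ pqrs xp xq xr xs)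
  ... | inj₂ xp | inj₁ xq | inj₁ xr | _       = ⊥-elim (noHouse′ (path-apqr pent) xa xp xq xr)
  ... | inj₂ xp | inj₁ xq | inj₂ xr | inj₁ xs = ⊥-elim (noHouse (path-sapq pent) xs xa xp xq)
  ... | inj₂ xp | inj₁ xq | inj₂ xr | inj₂ xs = ⊥-elim (pentagon-twin-≡ (rotate pent)
          (path-qrsa pent , xq , xr , xs , xa) (≢-sym x≢p))
  ... | inj₂ xp | inj₂ xq | inj₁ xr | _       = ⊥-elim (pentagon-twin-≡ (rotate (rotate (rotate (rotate pent))))
          (path-apqr pent , xa , xp , xq , xr) (≢-sym x≢s))

  pentagon-complete : ∀ {x a p q r s} → Pentagon c a p q r s → Outside x a p q r s → E x a →
                      E x p × E x q × E x r × E x s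
  pentagon-complete pent₀ (outside x≢a x≢p x≢q x≢r x≢s) xa =
    let pent₁ = rotate pent₀
        pent₂ = rotate pent₁
        pent₃ = rotate pent₂
        xp = pentagon-step pent₀ (outside x≢a x≢p x≢q x≢r x≢s) xa
        xq = pentagon-step pent₁ (outside x≢p x≢q x≢r x≢s x≢a) xp
        xr = pentagon-step pent₂ (outside x≢q x≢r x≢s x≢a x≢p) xq
        xs = pentagon-step pent₃ (outside x≢r x≢s x≢a x≢p x≢q) xr
    in  xp , xq , xr , xs

  -- Adjacency to any one vertex of the cycle spreads around it, by way of a.
  pentagon-unmixed : ∀ {x a p q r s} → Pentagon c a p q r s → (∀ i → x ≢ Vec.lookup (a ∷ p ∷ q ∷ r ∷ s ∷ []) i) →
                     ∀ i j → E x (Vec.lookup (a ∷ p ∷ q ∷ r ∷ s ∷ []) i) → E x (Vec.lookup (a ∷ p ∷ q ∷ r ∷ s ∷ []) j)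
  pentagon-unmixed {x} {a} {p} {q} {r} {s} pent₀ x∉ i j xi = spread (toA i xi) j
    where
    pent₁ = rotate pent₀
    pent₂ = rotate pent₁
    pent₃ = rotate pent₂
    pent₄ = rotate pent₃

    toA : ∀ i → E x (Vec.lookup (a ∷ p ∷ q ∷ r ∷ s ∷ []) i) → E x a
    toA 0F xa = xa
    toA 1F xp = let _ , _ , _ , xa = pentagon-complete pent₁ (outside (x∉ 1F) (x∉ 2F) (x∉ 3F) (x∉ 4F) (x∉ 0F)) xp in xa
    toA 2F xq = let _ , _ , xa , _ = pentagon-complete pent₂ (outside (x∉ 2F) (x∉ 3F) (x∉ 4F) (x∉ 0F) (x∉ 1F)) xq in xa
    toA 3F xr = let _ , xa , _ , _ = pentagon-complete pent₃ (outside (x∉ 3F) (x∉ 4F) (x∉ 0F) (x∉ 1F) (x∉ 2F)) xr in xa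
    toA 4F xs = let xa , _ , _ , _ = pentagon-complete pent₄ (outside (x∉ 4F) (x∉ 0F) (x∉ 1F) (x∉ 2F) (x∉ 3F)) xs in xa

    spread : E x a → ∀ j → E x (Vec.lookup (a ∷ p ∷ q ∷ r ∷ s ∷ []) j)
    spread xa j with pentagon-complete pent₀ (outside (x∉ 0F) (x∉ 1F) (x∉ 2F) (x∉ 3F) (x∉ 4F)) xa
    spread xa 0F | _                 = xa
    spread xa 1F | xp , _            = xp
    spread xa 2F | _ , xq , _        = xq
    spread xa 3F | _ , _ , xr , _    = xr
    spread xa 4F | _ , _ , _ , xs    = xs

pentagon-≅ : ∀ {n} (G : Graph (Fin n)) → Restricted (colouring G) → Prime (colouring G) →
             ∀ {a p q r s} → Pentagon (colouring G) a p q r s → G ≅ C 5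
pentagon-≅ G restricted prime {a} {p} {q} {r} {s} pent@(p4 pq qr rs pr ps qs , ap , aq , ar , as) =
  Pattern.≅-pattern G (C 5) (↔-id _) vs (ap , aq , ar , as , pq , pr , ps , qr , qs , rs) onto
  where
  open Colouring (colouring G)
  open Pentagons (colouring G) restricted prime

  vs = a ∷ p ∷ q ∷ r ∷ s ∷ []

  hit? : Unary.Decidable (λ v → ∃ λ i → Vec.lookup vs i ≡ v)
  hit? v = Finₚ.any? λ i → Vec.lookup vs i Finₚ.≟ v

  onto : ∀ v → ∃ λ i → Vec.lookup vs i ≡ v
  onto v with hit? v
  ... | yes hit = hit
  -- If the cycle misses a vertex, primality gives a vertex mixed on the cycle.
  ... | no ¬hit with w , _ , _ , ¬hitw , (i , refl) , (j , refl) , wi , wj ←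
               prime hit? (0F , refl) (1F , refl) (λ { refl → E-irrefl ap }) ¬hit =
    ⊥-elim (E∩N (pentagon-unmixed pent (λ k eq → ¬hitw (k , sym eq)) i j wi) wj)

-- Existence of an induced P₄

∃P4 : ∀ {V} → Colouring V → Set
∃P4 c = ∃ λ p → ∃ λ q → ∃ λ r → ∃ λ s → P4 c p q r s

third-vertex : ∀ {n} → 3 ≤ n → (u v : Fin n) → ∃ λ t → t ≢ u × t ≢ v
third-vertex (s≤s (s≤s (s≤s _))) zero          zero          = 1F , (λ ()) , (λ ())
third-vertex (s≤s (s≤s (s≤s _))) zero          (suc zero)    = 2F , (λ ()) , (λ ())
third-vertex (s≤s (s≤s (s≤s _))) zero          (suc (suc _)) = 1F , (λ ()) , (λ ())
third-vertex (s≤s (s≤s (s≤s _))) (suc zero)    zero          = 2F , (λ ()) , (λ ())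
third-vertex (s≤s (s≤s (s≤s _))) (suc (suc _)) zero          = 1F , (λ ()) , (λ ())
third-vertex (s≤s (s≤s (s≤s _))) (suc _)       (suc _)       = 0F , (λ ()) , (λ ())

module Separation {n : ℕ} where

  -- This includes disjointness, because `N` is irreflexive.
  Separated : Colouring (Fin n) → Subset n → Subset n → Set
  Separated c A B = ∀ {u v} → u ∈ˢ A → v ∈ˢ B → Colouring.N c u v

  Extension : Colouring (Fin n) → Fin n → Subset n → Subset n → Subset n → Subset n → Set
  Extension c x A B A′ B′ = ∃ (_∈ˢ A′) × ∃ (_∈ˢ B′) × Separated c A′ B′ ×
    (∀ {v} → v ∈ˢ A ⊎ v ∈ˢ B → v ∈ˢ A′ ⊎ v ∈ˢ B′) × (x ∈ˢ A′ ⊎ x ∈ˢ B′)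

  module _ (c : Colouring (Fin n)) where
    open Colouring c

    -- A vertex outside A lies in B and so is anticomplete to A; with two members A would be
    -- homogeneous.
    separated-subsingleton : Prime c → ∀ {A B a t b} → Separated c A B → (∀ v → v ∈ˢ A ⊎ v ∈ˢ B) →
                             a ∈ˢ A → t ∈ˢ A → b ∈ˢ B → ¬ a ≢ t
    separated-subsingleton prime {A} sep cover a∈A t∈A b∈B a≢t
      with w , _ , _ , w∉A , u∈A , _ , wu , _ ←
           prime (Subsetₚ._∈? A) a∈A t∈A a≢t (λ b∈A → N-irrefl (sep b∈A b∈B))
      with cover w
    ... | inj₁ w∈A = w∉A w∈A
    ... | inj₂ w∈B = E∩N (E-sym wu) (sep u∈A w∈B)

    separated-covering : Prime c → 3 ≤ n → ∀ {A B a b} → a ∈ˢ A → b ∈ˢ B → Separated c A B →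
                         ¬ (∀ v → v ∈ˢ A ⊎ v ∈ˢ B)
    separated-covering prime n≥3 {a = a} {b} a∈A b∈B sep cover with t , t≢a , t≢b ← third-vertex n≥3 a b with cover t
    ... | inj₁ t∈A = separated-subsingleton prime sep cover a∈A t∈A b∈B (≢-sym t≢a)
    ... | inj₂ t∈B = separated-subsingleton prime (λ u∈ v∈ → N-sym (sep v∈ u∈)) (Sum.swap ∘ cover)
                       b∈B t∈B a∈A (≢-sym t≢b)

    module _ {A B : Subset n} {x : Fin n} (x∉A : x ∉ˢ A) (sep : Separated c A B) where

      join-right : ∃ (_∈ˢ A) → ∃ (_∈ˢ B) → ¬ (∃ λ u → u ∈ˢ A × E x u) → ∃ λ B′ → Extension c x A B A B′
      join-right a∈ (b , b∈B) ¬edge = ⟦ B? ⟧ , a∈ , (b , ∈⟦⟧⁺ B? (inj₂ b∈B)) , sep′ ,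
        Sum.map₂ (∈⟦⟧⁺ B? ∘ inj₂) , inj₂ (∈⟦⟧⁺ B? (inj₁ refl))
        where
        B? : Unary.Decidable (λ v → v ≡ x ⊎ v ∈ˢ B)
        B? v = (v Finₚ.≟ x) ⊎-dec (v Subsetₚ.∈? B)

        sep′ : Separated c A ⟦ B? ⟧
        sep′ u∈A v∈ with ∈⟦⟧⁻ B? v∈
        ... | inj₂ v∈B = sep u∈A v∈B
        ... | inj₁ refl with E∪N (λ { refl → x∉A u∈A })
        ...   | inj₁ ux = contradiction (_ , u∈A , E-sym ux) ¬edge
        ...   | inj₂ ux = ux

      -- An edge uv in A with x adjacent to u only gives the path v₀ - x - u - v. Without such an
      -- edge, x and its neighbours in A can move to the other side.
      split-left : (∃ λ u → u ∈ˢ A × N x u) → (∃ λ v → v ∈ˢ B × E x v) →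
                   ∃P4 c ⊎ (∃ λ A′ → ∃ λ B′ → Extension c x A B A′ B′)
      split-left (u₀ , u₀∈A , xu₀) (v₀ , v₀∈B , xv₀)
        with Finₚ.any? (λ u → Finₚ.any? λ v →
               (u Subsetₚ.∈? A ×-dec E? x u) ×-dec (v Subsetₚ.∈? A ×-dec N? x v) ×-dec E? u v)
      ... | yes (u , v , (u∈A , xu) , (v∈A , xv) , uv) =
        inj₁ (v₀ , x , u , v , p4 (E-sym xv₀) xu uv (N-sym (sep u∈A v₀∈B)) (N-sym (sep v∈A v₀∈B)) xv)
      ... | no ¬edge = inj₂ (⟦ A? ⟧ , ⟦ B? ⟧ , (u₀ , ∈⟦⟧⁺ A? (u₀∈A , xu₀)) , (x , ∈⟦⟧⁺ B? (inj₁ refl)) ,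
                             sep′ , cover , inj₂ (∈⟦⟧⁺ B? (inj₁ refl)))
        where
        A? : Unary.Decidable (λ v → v ∈ˢ A × N x v)
        A? v = v Subsetₚ.∈? A ×-dec N? x v

        B? : Unary.Decidable (λ v → v ≡ x ⊎ v ∈ˢ B ⊎ (v ∈ˢ A × E x v))
        B? v = (v Finₚ.≟ x) ⊎-dec (v Subsetₚ.∈? B) ⊎-dec (v Subsetₚ.∈? A ×-dec E? x v)

        sep′ : Separated c ⟦ A? ⟧ ⟦ B? ⟧
        sep′ u∈ v∈ with ∈⟦⟧⁻ A? u∈ | ∈⟦⟧⁻ B? v∈
        ... | _   , xu | inj₁ refl              = N-sym xu
        ... | u∈A , _  | inj₂ (inj₁ v∈B)        = sep u∈A v∈B
        ... | u∈A , xu | inj₂ (inj₂ (v∈A , xv)) with E∪N (λ { refl → E∩N xv xu })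
        ...   | inj₁ uv = contradiction (_ , _ , (v∈A , xv) , (u∈A , xu) , E-sym uv) ¬edge
        ...   | inj₂ uv = uv

        cover : ∀ {v} → v ∈ˢ A ⊎ v ∈ˢ B → v ∈ˢ ⟦ A? ⟧ ⊎ v ∈ˢ ⟦ B? ⟧
        cover (inj₂ v∈B) = inj₂ (∈⟦⟧⁺ B? (inj₂ (inj₁ v∈B)))
        cover (inj₁ v∈A) with E∪N (λ { refl → x∉A v∈A })
        ... | inj₁ xv = inj₂ (∈⟦⟧⁺ B? (inj₂ (inj₂ (v∈A , xv))))
        ... | inj₂ xv = inj₁ (∈⟦⟧⁺ A? (v∈A , xv))

      -- A vertex complete to both sides is anticomplete to their union in the complement.
      dominate : ∃ (_∈ˢ A) → x ∉ˢ B → ¬ (∃ λ u → u ∈ˢ A × N x u) → ¬ (∃ λ v → v ∈ˢ B × N x v) →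
                 Extension (dual c) x A B ⁅ x ⁆ (A ∪ B)
      dominate (a , a∈A) x∉B ¬nonA ¬nonB =
        (x , Subsetₚ.x∈⁅x⁆ x) , (a , Subsetₚ.x∈p∪q⁺ (inj₁ a∈A)) , sep′ ,
        inj₂ ∘ Subsetₚ.x∈p∪q⁺ , inj₁ (Subsetₚ.x∈⁅x⁆ x)
        where
        edge : ∀ {S v} → x ∉ˢ S → ¬ (∃ λ u → u ∈ˢ S × N x u) → v ∈ˢ S → E x v
        edge x∉S ¬non v∈S with E∪N (λ { refl → x∉S v∈S })
        ... | inj₁ xv = xv
        ... | inj₂ xv = contradiction (_ , v∈S , xv) ¬non

        sep′ : Separated (dual c) ⁅ x ⁆ (A ∪ B)
        sep′ u∈ v∈ with refl ← Subsetₚ.x∈⁅y⁆⇒x≡y x u∈ =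
          Sum.[ edge x∉A ¬nonA , edge x∉B ¬nonB ] (Subsetₚ.x∈p∪q⁻ A B v∈)

  Extension-swap : ∀ {c x A B A′ B′} → Extension c x B A A′ B′ → Extension c x A B B′ A′
  Extension-swap {c} (a , b , sep , cover , x∈) =
    b , a , (λ u∈ v∈ → Colouring.N-sym c (sep v∈ u∈)) , Sum.swap ∘ cover ∘ Sum.swap , Sum.swap x∈

  extend : ∀ c {A B x} → x ∉ˢ A → x ∉ˢ B → ∃ (_∈ˢ A) → ∃ (_∈ˢ B) → Separated c A B →
           ∃P4 c ⊎ (∃ λ A′ → ∃ λ B′ → Extension c x A B A′ B′ ⊎ Extension (dual c) x A B A′ B′)
  extend c {A} {B} {x} x∉A x∉B a∈ b∈ sep
    with Finₚ.any? (λ u → u Subsetₚ.∈? A ×-dec E? x u) | Finₚ.any? (λ u → u Subsetₚ.∈? B ×-dec E? x u)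
    where open Colouring c
  ... | no ¬edge | _        = let B′ , ext = join-right c x∉A sep a∈ b∈ ¬edge in inj₂ (A , B′ , inj₁ ext)
  ... | yes _    | no ¬edge =
    let A′ , ext = join-right c x∉B (λ u∈ v∈ → Colouring.N-sym c (sep v∈ u∈)) b∈ a∈ ¬edge
    in  inj₂ (A′ , B , inj₁ (Extension-swap {c} ext))
  ... | yes edgeA | yes edgeB
    with Finₚ.any? (λ u → u Subsetₚ.∈? A ×-dec Colouring.N? c x u) | Finₚ.any? (λ u → u Subsetₚ.∈? B ×-dec Colouring.N? c x u)
  ...   | yes nonA | _        = Sum.map₂ (map₂ (map₂ inj₁)) (split-left c x∉A sep nonA edgeB)
  ...   | no _     | yes nonB =
    Sum.map₂ (λ (B′ , A′ , ext) → A′ , B′ , inj₁ (Extension-swap {c} ext))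
      (split-left c x∉B (λ u∈ v∈ → Colouring.N-sym c (sep v∈ u∈)) nonB edgeA)
  ...   | no ¬nonA | no ¬nonB = inj₂ (⁅ x ⁆ , A ∪ B , inj₂ (dominate c x∉A sep a∈ x∉B ¬nonA ¬nonB))

  extension-⊂ : ∀ {c x A B A′ B′} → x ∉ˢ A ∪ B → Extension c x A B A′ B′ → (A ∪ B) ⊂ˢ (A′ ∪ B′)
  extension-⊂ {x = x} {A} {B} x∉ (_ , _ , _ , cover , x∈) =
    Subsetₚ.x∈p∪q⁺ ∘ cover ∘ Subsetₚ.x∈p∪q⁻ A B , x , Subsetₚ.x∈p∪q⁺ x∈ , x∉

  -- The union of the two sides grows strictly at each step, even when the step passes to the
  -- complement, so the induction is on this union.
  separated⇒P4 : ∀ c → Prime c → 3 ≤ n → ∀ {A B} → Acc _⊃ˢ_ (A ∪ B) →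
                 ∃ (_∈ˢ A) → ∃ (_∈ˢ B) → Separated c A B → ∃P4 c
  separated⇒P4 c prime n≥3 {A} {B} (acc rec) a∈ b∈ sep
    with Finₚ.any? (λ x → ¬? (x Subsetₚ.∈? (A ∪ B)))
  ... | no all = ⊥-elim (separated-covering c prime n≥3 (proj₂ a∈) (proj₂ b∈) sep cover)
    where
    cover : ∀ v → v ∈ˢ A ⊎ v ∈ˢ B
    cover v with v Subsetₚ.∈? (A ∪ B)
    ... | yes v∈ = Subsetₚ.x∈p∪q⁻ A B v∈
    ... | no v∉  = contradiction (v , v∉) all
  ... | yes (x , x∉) with extend c (x∉ ∘ Subsetₚ.x∈p∪q⁺ ∘ inj₁) (x∉ ∘ Subsetₚ.x∈p∪q⁺ ∘ inj₂) a∈ b∈ sep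
  ...   | inj₁ path = path
  ...   | inj₂ (_ , _ , inj₁ ext@(a∈′ , b∈′ , sep′ , _)) =
    separated⇒P4 c prime n≥3 (rec (extension-⊂ {c} x∉ ext)) a∈′ b∈′ sep′
  ...   | inj₂ (_ , _ , inj₂ ext@(a∈′ , b∈′ , sep′ , _)) =
    let p , q , r , s , path = separated⇒P4 (dual c) (Prime-dual {c = c} prime) n≥3
                                 (rec (extension-⊂ {dual c} x∉ ext)) a∈′ b∈′ sep′
    in  r , p , s , q , P4-dual path

  nonadjacent⇒P4 : ∀ c → Prime c → 3 ≤ n → ∀ {u v} → Colouring.N c u v → ∃P4 c
  nonadjacent⇒P4 c prime n≥3 {u} {v} uv = separated⇒P4 c prime n≥3 (⊃-wellFounded (⁅ u ⁆ ∪ ⁅ v ⁆))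
    (u , Subsetₚ.x∈⁅x⁆ u) (v , Subsetₚ.x∈⁅x⁆ v)
    λ s∈ t∈ → subst₂ (Colouring.N c) (sym (Subsetₚ.x∈⁅y⁆⇒x≡y u s∈)) (sym (Subsetₚ.x∈⁅y⁆⇒x≡y v t∈)) uv

prime⇒P4 : ∀ {n} (c : Colouring (Fin n)) → Prime c → 3 ≤ n → ∃P4 c
prime⇒P4 c prime n≥3@(s≤s (s≤s _)) with Colouring.E∪N c {0F} {1F} (λ ())
... | inj₂ nonadj = Separation.nonadjacent⇒P4 c prime n≥3 nonadj
... | inj₁ adj    =
  let p , q , r , s , path = Separation.nonadjacent⇒P4 (dual c) (Prime-dual {c = c} prime) n≥3 adj
  in  r , p , s , q , P4-dual path

-- Growing a half graph

Covers : ∀ {V} → List (V × V) → Set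
Covers hs = ∀ v → Any (λ p → v ≡ proj₁ p ⊎ v ≡ proj₂ p) hs

-- The second and fourth vertices serve as a₁ and a₂, the first and third as b₁ and b₂.
P4⇒half : ∀ {V} {c : Colouring V} {p q r s} → P4 c p q r s → Half c ((q , p) ∷ (s , r) ∷ [])
P4⇒half {c = c} (p4 pq qr rs pr ps qs) =
  (before qr qs pr ps ∷ []) ∷ [] ∷ [] , E-sym pq ∷ E-sym rs ∷ []
  where open Colouring c

module Enlarge {n : ℕ} (c : Colouring (Fin n)) (restricted : Restricted c) (noC5 : C5Free c) (prime : Prime c) where
  open Colouring c
  open HalfGrowth c restricted noC5

  On : List (Fin n × Fin n) → Fin n → Set
  On hs v = Any (λ p → v ≡ proj₁ p ⊎ v ≡ proj₂ p) hs

  on? : ∀ hs → Unary.Decidable (On hs)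
  on? hs v = Any.any? (λ (a , b) → (v Finₚ.≟ a) ⊎-dec (v Finₚ.≟ b)) hs

  on-elim : ∀ {Q : Fin n → Set} {hs v} → All (λ (a , b) → Q a × Q b) hs → On hs v → Q v
  on-elim qs on with find on
  ... | _ , p∈ , inj₁ refl = proj₁ (All.lookup qs p∈)
  ... | _ , p∈ , inj₂ refl = proj₂ (All.lookup qs p∈)

  -- If a vertex is missed, primality of the covered set gives a vertex mixed on it; mixedness
  -- excludes the complete and anticomplete attachments.
  enlarge : ∀ hs → 2 ≤ length hs → Half c hs → Covers hs ⊎ Larger hs
  enlarge hs@(_ ∷ _) two half@(_ , r ∷ _) with Finₚ.any? (¬? ∘ on? hs)
  ... | no all = inj₁ λ v → decidable-stable (on? hs v) (λ v∉ → all (v , v∉))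
  ... | yes (t , t∉)
    with x , u , v , x∉ , u∈ , v∈ , xu , xv ←
         prime (on? hs) (here (inj₁ refl)) (here (inj₂ refl)) (λ { refl → E-irrefl r }) t∉
       = inj₂ (enlarge-attached prime two half
           (All.map (λ ¬p → status (¬p ∘ inj₁) (¬p ∘ inj₂)) (Allₚ.¬Any⇒All¬ hs x∉))
           (λ p∈ → x∉ ∘ lose p∈ ∘ inj₁ , x∉ ∘ lose p∈ ∘ inj₂)
           (λ ns → E∩N xu (on-elim ns u∈))
           (λ bs → E∩N (on-elim bs v∈) xv))

-- From a covering list to an isomorphism with O_k

module HalfIso {n : ℕ} (c : Colouring (Fin n)) (hs : List (Fin n × Fin n)) (half : Half c hs) where
  open Colouring c

  a b : Fin (length hs) → Fin n
  a = proj₁ ∘ lookup hs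
  b = proj₂ ∘ lookup hs

  ab-≤ : ∀ {i j} → i Fin.≤ j → E (a i) (b j)
  ab-≤ {i} {j} i≤j with Finₚ.<-cmp i j
  ... | tri< i<j _ _  = Before.ab (AllPairs-lookup (proj₁ half) i<j)
  ... | tri≈ _ refl _ = All.lookup (proj₂ half) (∈-lookup i)
  ... | tri> _ _ j<i  = contradiction i≤j (ℕₚ.<⇒≱ j<i)

  ab-> : ∀ {i j} → j Fin.< i → N (a i) (b j)
  ab-> j<i = N-sym (Before.ba (AllPairs-lookup (proj₁ half) j<i))

  aa : ∀ {i j} → i ≢ j → N (a i) (a j)
  aa {i} {j} i≢j with Finₚ.<-cmp i j
  ... | tri< i<j _ _ = Before.aa (AllPairs-lookup (proj₁ half) i<j)
  ... | tri≈ _ i≡j _ = contradiction i≡j i≢j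
  ... | tri> _ _ j<i = N-sym (Before.aa (AllPairs-lookup (proj₁ half) j<i))

  bb : ∀ {i j} → i ≢ j → N (b i) (b j)
  bb {i} {j} i≢j with Finₚ.<-cmp i j
  ... | tri< i<j _ _ = Before.bb (AllPairs-lookup (proj₁ half) i<j)
  ... | tri≈ _ i≡j _ = contradiction i≡j i≢j
  ... | tri> _ _ j<i = N-sym (Before.bb (AllPairs-lookup (proj₁ half) j<i))

  a-injective : Injective _≡_ _≡_ a
  a-injective {i} {j} eq with i Finₚ.≟ j
  ... | yes i≡j = i≡j
  ... | no i≢j  = contradiction (subst (N (a i)) (sym eq) (aa i≢j)) N-irrefl

  b-injective : Injective _≡_ _≡_ b
  b-injective {i} {j} eq with i Finₚ.≟ j
  ... | yes i≡j = i≡j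
  ... | no i≢j  = contradiction (subst (N (b i)) (sym eq) (bb i≢j)) N-irrefl

  a≢b : ∀ i j → a i ≢ b j
  a≢b i j eq with i Finₚ.≤? j
  ... | yes i≤j = E-irrefl (subst (E (a i)) (sym eq) (ab-≤ i≤j))
  ... | no i≰j  = N-irrefl (subst (N (a i)) (sym eq) (ab-> (ℕₚ.≰⇒> i≰j)))

  aa-not : ∀ i j → ¬ E (a i) (a j)
  aa-not i j e with i Finₚ.≟ j
  ... | yes refl = E-irrefl e
  ... | no i≢j   = E∩N e (aa i≢j)

  bb-not : ∀ i j → ¬ E (b i) (b j)
  bb-not i j e with i Finₚ.≟ j
  ... | yes refl = E-irrefl e
  ... | no i≢j   = E∩N e (bb i≢j)

  length≤n : length hs ≤ n
  length≤n = Finₚ.injective⇒≤ a-injective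

  k = length hs

  -- The list numbers the a's backwards. With indices from 0, `opposite i` is k - 1 - i, and k - 1 -
  -- i ≤ j amounts to k + 1 ≤ (i + 1) + (j + 1).
  opposite-≤⇒arc : ∀ {i j : Fin k} → opposite i Fin.≤ j → HalfArc k (inj₁ i) (inj₂ j)
  opposite-≤⇒arc {i} {j} le = begin
    k + 1                           ≤⟨ ℕₚ.+-monoˡ-≤ 1 (ℕₚ.m≤n+m∸n k (suc (toℕ i))) ⟩
    suc (toℕ i) + (k ∸ suc (toℕ i)) + 1 ≡⟨ cong (λ m → suc (toℕ i) + m + 1) (Finₚ.opposite-prop i) ⟨
    suc (toℕ i) + toℕ (opposite i) + 1 ≤⟨ ℕₚ.+-monoˡ-≤ 1 (ℕₚ.+-monoʳ-≤ (suc (toℕ i)) le) ⟩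
    suc (toℕ i) + toℕ j + 1         ≡⟨ ℕₚ.+-assoc (suc (toℕ i)) (toℕ j) 1 ⟩
    suc (toℕ i) + (toℕ j + 1)       ≡⟨ cong (suc (toℕ i) +_) (ℕₚ.+-comm (toℕ j) 1) ⟩
    suc (toℕ i) + suc (toℕ j)       ∎
    where open ℕₚ.≤-Reasoning

  arc⇒opposite-≤ : ∀ {i j : Fin k} → HalfArc k (inj₁ i) (inj₂ j) → opposite i Fin.≤ j
  arc⇒opposite-≤ {i} {j} arc = subst (_≤ toℕ j) (sym (Finₚ.opposite-prop i))
    (ℕₚ.m≤n+o⇒m∸n≤o k (suc (toℕ i)) (ℕₚ.+-cancelʳ-≤ 1 k (suc (toℕ i) + toℕ j)
      (subst (k + 1 ≤_) (trans (cong (suc (toℕ i) +_) (ℕₚ.+-comm 1 (toℕ j)))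
                               (sym (ℕₚ.+-assoc (suc (toℕ i)) (toℕ j) 1))) arc)))

  place : Fin k ⊎ Fin k → Fin n
  place (inj₁ i) = a (opposite i)
  place (inj₂ j) = b j

  place-injective : Injective _≡_ _≡_ place
  place-injective {inj₁ i} {inj₁ j} eq = cong inj₁ (trans (sym (Finₚ.opposite-involutive i))
    (trans (cong opposite (a-injective eq)) (Finₚ.opposite-involutive j)))
  place-injective {inj₁ i} {inj₂ j} eq = contradiction eq (a≢b (opposite i) j)
  place-injective {inj₂ i} {inj₁ j} eq = contradiction (sym eq) (a≢b (opposite j) i)
  place-injective {inj₂ i} {inj₂ j} eq = cong inj₂ (b-injective eq)

  ab⇒arc : ∀ {i j} → E (a (opposite i)) (b j) → HalfArc k (inj₁ i) (inj₂ j)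
  ab⇒arc {i} {j} e with opposite i Finₚ.≤? j
  ... | yes le = opposite-≤⇒arc le
  ... | no ≰   = contradiction (ab-> (ℕₚ.≰⇒> ≰)) (E∩N e)

  place-adjacent : ∀ s t → E (place s) (place t) ⇔ Adj (O k) s t
  place-adjacent (inj₁ i) (inj₁ j) = mk⇔ (⊥-elim ∘ aa-not _ _) λ { (inj₁ ()) ; (inj₂ ()) }
  place-adjacent (inj₂ i) (inj₂ j) = mk⇔ (⊥-elim ∘ bb-not _ _) λ { (inj₁ ()) ; (inj₂ ()) }
  place-adjacent (inj₁ i) (inj₂ j) = mk⇔ (inj₁ ∘ ab⇒arc) λ { (inj₁ arc) → ab-≤ (arc⇒opposite-≤ arc) ; (inj₂ ()) }
  place-adjacent (inj₂ j) (inj₁ i) =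
    mk⇔ (inj₂ ∘ ab⇒arc ∘ E-sym) λ { (inj₂ arc) → E-sym (ab-≤ (arc⇒opposite-≤ arc)) ; (inj₁ ()) }

  place-onto : Covers hs → ∀ v → ∃ λ s → place s ≡ v
  place-onto covers v with covers v
  ... | on with Any.index on | Anyₚ.lookup-index on
  ...   | i | inj₁ refl = inj₁ (opposite i) , cong a (Finₚ.opposite-involutive i)
  ...   | i | inj₂ refl = inj₂ i , refl

  half≅O : ∀ (G : Graph (Fin n)) → (∀ {u v} → Adj G u v ⇔ E u v) → Covers hs → G ≅ O k
  half≅O G iff covers = ≅-fromEmbedding place place-injective (place-onto covers)
    λ s t → mk⇔ (Equivalence.to (place-adjacent s t) ∘ Equivalence.to iff)
                (Equivalence.from iff ∘ Equivalence.from (place-adjacent s t))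

Covered : ∀ {n} → Colouring (Fin n) → Set
Covered c = ∃ λ hs → 1 ≤ length hs × Half c hs × Covers hs

-- `Before` has the whole colouring as a parameter, so its fields are repackaged.
Covered-dual-dual : ∀ {n} {c : Colouring (Fin n)} → Covered (dual (dual c)) → Covered c
Covered-dual-dual (hs , k≥1 , (bs , rs) , covers) =
  hs , k≥1 , (AllPairs.map (λ (before ab aa bb ba) → before ab aa bb ba) bs , rs) , covers

-- Each round adds one pair, and distinctness of the a's allows at most n pairs, so `fuel` bounds
-- the remaining rounds. If the larger half graph lies in the complement, the growth continues
-- there.
grow : ∀ {n} (c : Colouring (Fin n)) → Restricted c → C5Free c → Prime c →
       ∀ fuel hs → n < fuel + length hs → 2 ≤ length hs → Half c hs → Covered c ⊎ Covered (dual c)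
grow c restricted noC5 prime zero hs n<k two half =
  contradiction (HalfIso.length≤n c hs half) (ℕₚ.<⇒≱ n<k)
grow {n} c restricted noC5 prime (suc fuel) hs n<k two half with Enlarge.enlarge c restricted noC5 prime hs two half
... | inj₁ covers = inj₁ (hs , ℕₚ.<⇒≤ two , half , covers)
... | inj₂ (hs′ , eq , bigger) = Sum.[ same , other ] bigger
  where
  n<k′ : n < fuel + length hs′
  n<k′ = subst (n <_) (trans (sym (ℕₚ.+-suc fuel (length hs))) (cong (fuel +_) (sym eq))) n<k

  two′ : 2 ≤ length hs′
  two′ = subst (2 ≤_) (sym eq) (ℕₚ.m≤n⇒m≤1+n two)

  same : Half c hs′ → Covered c ⊎ Covered (dual c)
  same = grow c restricted noC5 prime fuel hs′ n<k′ two′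

  other : Half (dual c) hs′ → Covered c ⊎ Covered (dual c)
  other half′ = Sum.swap (Sum.map₂ Covered-dual-dual
    (grow (dual c) (Restricted-dual restricted) (C5Free-dual {c = c} noC5) (Prime-dual {c = c} prime)
      fuel hs′ n<k′ two′ half′))

-- Primality

mixed? : ∀ {n} (G : Graph (Fin n)) b X → Dec (Mixed G b X)
mixed? G b X = ¬? (b Subsetₚ.∈? X) ×-dec
  Finₚ.any? (λ v → v Subsetₚ.∈? X ×-dec Graph._~?_ G b v) ×-dec
  Finₚ.any? (λ v → v Subsetₚ.∈? X ×-dec ¬? (Graph._~?_ G b v))

homogeneous? : ∀ {n} (G : Graph (Fin n)) → Unary.Decidable (Homogeneous G)
homogeneous? {n} G X = (1 ℕₚ.<? ∣ X ∣) ×-dec (∣ X ∣ ℕₚ.<? n) ×-dec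
  Finₚ.all? (λ b → ¬? (b Subsetₚ.∈? X) →-dec ¬? (mixed? G b X))

1<∣X∣ : ∀ {n} {X : Subset n} {u v} → u ∈ˢ X → v ∈ˢ X → u ≢ v → 1 < ∣ X ∣
1<∣X∣ {X = X} {u} {v} u∈X v∈X u≢v = subst (_< ∣ X ∣) (Subsetₚ.∣⁅x⁆∣≡1 u) (Subsetₚ.p⊂q⇒∣p∣<∣q∣
  ( (λ t∈ → subst (_∈ˢ X) (sym (Subsetₚ.x∈⁅y⁆⇒x≡y u t∈)) u∈X)
  , v , v∈X , λ v∈ → u≢v (sym (Subsetₚ.x∈⁅y⁆⇒x≡y u v∈))))

∣X∣<n : ∀ {n} {X : Subset n} {t} → t ∉ˢ X → ∣ X ∣ < n
∣X∣<n {n} {X} t∉X = subst (∣ X ∣ <_) (Subsetₚ.∣⊤∣≡n n)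
  (Subsetₚ.p⊂q⇒∣p∣<∣q∣ ((λ _ → Subsetₚ.∈⊤) , _ , Subsetₚ.∈⊤ , t∉X))

-- Since mixedness is decidable, a search over all vertices produces the mixed vertex; if it fails,
-- the set is homogeneous.
¬homogeneous⇒prime : ∀ {n} (G : Graph (Fin n)) → ¬ ∃ (Homogeneous G) → Prime (colouring G)
¬homogeneous⇒prime G ¬hom {Q} Q? qu qv u≢v ¬qt
  with Finₚ.any? (λ w → mixed? G w ⟦ Q? ⟧)
... | yes (w , w∉ , (a , a∈ , wa) , (b , b∈ , wb)) =
  w , a , b , w∉ ∘ ∈⟦⟧⁺ Q? , ∈⟦⟧⁻ Q? a∈ , ∈⟦⟧⁻ Q? b∈ , wa , (λ { refl → w∉ b∈ }) , wb
... | no unmixed = contradiction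
  ( ⟦ Q? ⟧ , 1<∣X∣ (∈⟦⟧⁺ Q? qu) (∈⟦⟧⁺ Q? qv) u≢v , ∣X∣<n (¬qt ∘ ∈⟦⟧⁻ Q?)
  , λ b _ mixed → unmixed (b , mixed)) ¬hom

-- The final case distinction

∃-pentagon? : ∀ {n} (c : Colouring (Fin n)) →
  Dec (∃ λ a → ∃ λ p → ∃ λ q → ∃ λ r → ∃ λ s → Pentagon c a p q r s)
∃-pentagon? c = Finₚ.any? λ a → Finₚ.any? λ p → Finₚ.any? λ q → Finₚ.any? λ r → Finₚ.any? λ s →
  Pentagon? c a p q r s

theorem4p4 : ∀ (n : ℕ) (G : Graph (Fin n)) →
    Free ((-, P 5) ∷ (-, complement (P 5)) ∷ (-, bull) ∷ []) G →
    (n ≤ 2) ⊎ (G ≅ C 5) ⊎ (∃ λ X → Homogeneous G X) ⊎ (HalfGraph G ⊎ HalfGraph (complement G))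
theorem4p4 n G free with n ℕₚ.≤? 2 | Subsetₚ.anySubset? (homogeneous? G) | ∃-pentagon? (colouring G)
... | yes n≤2 | _       | _ = inj₁ n≤2
... | no _    | yes hom | _ = inj₂ (inj₂ (inj₁ hom))
... | no _    | no ¬hom | yes (_ , _ , _ , _ , _ , pent) =
  inj₂ (inj₁ (pentagon-≅ G (restrict G free) (¬homogeneous⇒prime G ¬hom) pent))
... | no n≰2  | no ¬hom | no ¬pent = inj₂ (inj₂ (inj₂ (Sum.map half co-half
    -- The P₄ provides two pairs, so n rounds suffice, as n < n + 2.
    (grow c (restrict G free) noC5 prime n _ (ℕₚ.m<m+n n (s≤s z≤n)) (s≤s (s≤s z≤n)) (P4⇒half path)))))
  where
  c = colouring G

  prime : Prime c
  prime = ¬homogeneous⇒prime G ¬hom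

  noC5 : C5Free c
  noC5 path xp xq xr xs = ¬pent (_ , _ , _ , _ , _ , path , xp , xq , xr , xs)

  path = proj₂ (proj₂ (proj₂ (proj₂ (prime⇒P4 c prime (ℕₚ.≰⇒> n≰2)))))

  half : Covered c → HalfGraph G
  half (hs , k≥1 , h , covers) = length hs , k≥1 , HalfIso.half≅O c hs h G (mk⇔ id id) covers

  co-half : Covered (dual c) → HalfGraph (complement G)
  co-half (hs , k≥1 , h , covers) =
    length hs , k≥1 , HalfIso.half≅O (dual c) hs h (complement G) (mk⇔ id id) covers
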